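{- For every odd $m\ge 3$ and $i\in\{1,2\}$, the Boolean function associated with the Sperner system $\mathcal{S}^m_i$ is self-dual.
   Context: A Sperner system over a finite set $A$ is a set of subsets of $A$, called blocks, none of which is included in another. The Boolean function associated with a Sperner system $\mathcal A$ over an $n$-element set $A$ (identified with $\{1,\dots,n\}$ via a fixed bijection) is the $n$-ary function $\bigvee_{S\in\mathcal A}\bigwedge_{i\in S}x_i$ on $\{0,1\}$. A Boolean function $f\colon\{0,1\}^n\to\{0,1\}$ is self-dual if $f(\mathbf a)=\overline{f(\overline{\mathbf a})}$ for all $\mathbf a$, where $\overline0=1$, $\overline1=0$, applied componentwise to tuples. Let $[m]=\{1,\dots,m\}$. For each $n\in[m]$ let $n'$ be a new element (a primed copy of $n$), and $S'=\{n':n\in S\}$ for $S\subseteq[m]$. Let $E_m=[m]\cup[m]'$ ($2m$ elements). Addition in $[m]$ is modulo $m$ with result in $[m]$; $X+q=\{x+q:x\in X\}$. Let $\rho$ be the permutation of $E_m$ with $\rho(j)=j+1$, $\rho(j')=(j+1)'$; for a set system (set of subsets) $\mathcal A$ over $E_m$ let $\langle\mathcal A\rangle=\bigcup_{i\in[m]}\rho^i(\mathcal A)$, where $\rho^i(\mathcal A)=\{\rho^i(S):S\in\mathcal A\}$. For $J\subseteq[m]$ let $F^m_J=J\cup([m]\setminus J)'$; $\mathcal F^m_1=\{F^m_J:|J|\text{ odd}\}$, $\mathcal F^m_2=\{F^m_J:|J|\text{ even}\}$. For disjoint $X,Y\subseteq[m]$ let $[X|Y]$ be the set of all $J\subseteq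 E_m$ such that $|\{x,x'\}\cap J|=2$ for all $x\in X$, $|\{y,y'\}\cap J|=0$ for all $y\in Y$, and $|\{z,z'\}\cap J|=1$ for all $z\in[m]\setminus(X\cup Y)$. Let $\langle X|Y\rangle=\langle[X|Y]\rangle=\bigcup_{q\in[m]}[X+q|Y+q]$. Let $\Omega=\{\langle X|Y\rangle: X,Y\subseteq[m],\ |X|=|Y|,\ X\cap Y=\emptyset\}\setminus\{\langle\emptyset|\emptyset\rangle\}$. Signature: for disjoint $X,Y\subseteq[m]$, $(X,Y)\ne(\emptyset,\emptyset)$, let $d_1\dots d_m$ be the string with $d_i=x$ if $i\in X$, $d_i=y$ if $i\in Y$, $d_i=z$ otherwise. Let $d'_1\dots d'_m$ be the unique string (indices cyclic modulo $m$) such that $d'_i=d_i$ if $d_i\in\{x,y\}$; and if $d_i=z$ then $d'_i\in\{\alpha,\beta\}$, $d'_i\ne d'_{i-1}$, with $d'_i=\beta$ if $d_{i-1}=x$ and $d'_i=\alpha$ if $d_{i-1}=y$. Then $\mathrm{sgn}(X,Y)$ is the set of those $e\in\{\alpha,\beta\}$ that occur an odd number of times in $d'_1\dots d'_m$; the singletons $\{\alpha\},\{\beta\}$ are written $\alpha,\beta$. It is invariant under replacing $(X,Y)$ by $(X+q,Y+q)$, and $\mathrm{sgn}\langle X|Y\rangle:=\mathrm{sgn}(X,Y)$ is well defined. For odd $m\ge3$ let $C_m=\{1,3,\dots,m-2\}$, $A_m=\{m\}\cup(C_m+1)\cup(C_m+1)'$, $B_m=\{m\}\cup C_m\cup C_m'$,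 and $$\mathcal H^m=\langle\{A_m,B_m\}\rangle\cup\bigcup\{Q\in\Omega\setminus\{\langle C_m|C_m+1\rangle,\langle C_m+1|C_m\rangle\}:\mathrm{sgn}\,Q=\beta\}.$$ For $i\in\{1,2\}$ let $\mathcal S^m_i=\mathcal H^m\cup\mathcal F^m_i$, a Sperner system over $E_m$. -}

module Defs where

open import Data.Bool.Base using (Bool; true; false; not; _∨_; if_then_else_)
import Data.Bool.Properties as Bool
open import Data.Fin.Base using (Fin; zero; suc; toℕ; inject₁; splitAt; join)
open import Data.Fin.Properties as Fin using (any?; all?; toℕ<n; toℕ-injective; toℕ-fromℕ<)
open import Data.Fin.Subset
  using (Subset; _∈_; _∉_; _⊆_; ⁅_⁆; ∁; _∩_; _∪_; ∣_∣; Empty)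
  renaming (⊥ to ∅)
open import Data.Fin.Subset.Properties as Subset
  using (_∈?_; nonempty?; anySubset?; p⊂q⇒∣p∣<∣q∣)
open import Data.Nat.Base using (ℕ; zero; suc; _+_; _∸_; _≤_; _<_; s≤s)
import Data.Nat.Properties as ℕ
open import Data.Nat.Divisibility
  using (_∣_; _∣?_; ∣-refl; ∣1⇒≡1; ∣m+n∣m⇒∣n; ∣m∣n⇒∣m+n; _∣0)
open import Data.Nat.Solver using (module +-*-Solver)
open import Data.Nat.DivMod using (_%_; _mod_; %-distribˡ-+; [m+n]%n≡m%n; m<n⇒m%n≡m; m%n<n)
open import Data.Nat.GeneralisedArithmetic using (iterate)
open import Data.Product.Base using (∃; ∃₂; _×_; _,_; proj₁; proj₂)
open import Data.Sum.Base as Sum using (_⊎_; inj₁; inj₂)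
import Data.Sum.Properties as Sum
open import Data.Vec.Base as Vec using (Vec; []; _∷_; _++_; lookup; tabulate; count)
open import Data.Vec.Properties as Vec
  using (≡-dec; []=⇒lookup; lookup⇒[]=; lookup∘tabulate; lookup-zipWith; lookup-map; zipWith-++)
open import Function.Base using (_∘_)
open import Level using (0ℓ)
open import Relation.Binary.Definitions using (DecidableEquality)
open import Relation.Binary.PropositionalEquality
  using (_≡_; _≢_; refl; sym; trans; cong; cong₂; subst; module ≡-Reasoning)
open import Relation.Nullary using (¬_; Dec; yes; no; does; ¬?; contradiction)
open import Relation.Nullary.Decidable
  using (_×-dec_; _⊎-dec_; _→-dec_; map′; decidable-stable; dec-true; dec-false)
open import Relation.Unary using (Pred; Decidable; _≐_; ｛_｝)

private
  variable
    k m n : ℕ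

------------------------------------------------------------------------

SetSystem : ℕ → Set₁
SetSystem n = Pred (Subset n) 0ℓ

-- Decidability carries no mathematical content: it is what makes the
-- disjunction over all blocks below a value of type Bool.
record SpernerSystem (n : ℕ) : Set₁ where
  field
    Block   : SetSystem n
    block?  : Decidable Block
    sperner : ∀ {S T} → Block S → Block T → S ⊆ T → S ≡ T

BooleanFunction : ℕ → Set
BooleanFunction n = Vec Bool n → Bool

-- a ↦ ⋁_{S block} ⋀_{i ∈ S} aᵢ
booleanFunction : SpernerSystem n → BooleanFunction n
booleanFunction 𝒜 a = does (anySubset? λ S →
  block? S ×-dec all? λ i → (i ∈? S) →-dec (lookup a i Bool.≟ true))
  where open SpernerSystem 𝒜

SelfDual : BooleanFunction n → Set
SelfDual f = ∀ a → f a ≡ not (f (Vec.map not a))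

------------------------------------------------------------------------

Odd : ℕ → Set
Odd n = ¬ (2 ∣ n)

comprehension : {P : Pred (Fin n) 0ℓ} → Decidable P → Subset n
comprehension P? = tabulate (λ i → does (P? i))

image : (Fin k → Fin n) → Subset k → Subset n
image f S = comprehension {P = λ i → ∃ λ j → j ∈ S × f j ≡ i}
  (λ i → any? (λ j → (j ∈? S) ×-dec (f j Fin.≟ i)))

-- [m] is Fin m, where i : Fin m stands for the number label i.
label : Fin m → ℕ
label i = suc (toℕ i)

infixl 6 _⊕_
_⊕_ : Fin m → ℕ → Fin m
_⊕_ {m = suc m} i q = (toℕ i + q) mod suc m

_+ˢ_ : Subset m → ℕ → Subset m
X +ˢ q = image (_⊕ q) X

-- E m = [m] ∪ [m]′ is Fin (m + m): the left summand is [m] and the right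
-- one is [m]′.  This is also the bijection with {1,…,2m} used to form
-- Boolean functions of systems over E m.
E : ℕ → Set
E m = Fin (m + m)

-- X ∪′ Y is X ∪ Y′.
infixr 5 _∪′_
_∪′_ : Subset m → Subset m → Subset (m + m)
X ∪′ Y = X ++ Y

ρ : ∀ m → E m → E m
ρ m e = join m m (Sum.map (_⊕ 1) (_⊕ 1) (splitAt m e))

-- ⟨𝒜⟩
orbit : ∀ m → SetSystem (m + m) → SetSystem (m + m)
orbit m 𝒜 T = ∃ λ (i : Fin m) → ∃ λ S →
  𝒜 S × T ≡ image (λ e → iterate (ρ m) e (label i)) S

------------------------------------------------------------------------

F : Subset m → Subset (m + m)
F J = J ∪′ ∁ J

𝓕₁ 𝓕₂ : ∀ m → SetSystem (m + m)
𝓕₁ m T = ∃ λ (J : Subset m) → Odd ∣ J ∣ × T ≡ F J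
𝓕₂ m T = ∃ λ (J : Subset m) → 2 ∣ ∣ J ∣ × T ≡ F J

------------------------------------------------------------------------

Disjoint : Subset m → Subset m → Set
Disjoint X Y = Empty (X ∩ Y)

[_∥_] : Subset m → Subset m → SetSystem (m + m)
[ X ∥ Y ] J = ∀ j → let pair = ⁅ j ⁆ ∪′ ⁅ j ⁆ in
  (j ∈ X         → ∣ pair ∩ J ∣ ≡ 2) ×
  (j ∈ Y         → ∣ pair ∩ J ∣ ≡ 0) ×
  (j ∉ X × j ∉ Y → ∣ pair ∩ J ∣ ≡ 1)

⟨_∥_⟩ : Subset m → Subset m → SetSystem (m + m)
⟨_∥_⟩ {m} X Y = orbit m [ X ∥ Y ]

-- The pairs (X , Y) for which ⟨ X ∥ Y ⟩ belongs to Ω.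
InΩ : Subset m → Subset m → Set
InΩ {m} X Y = ∣ X ∣ ≡ ∣ Y ∣ × Disjoint X Y × ¬ (⟨ X ∥ Y ⟩ ≐ ⟨ ∅ {m} ∥ ∅ ⟩)

------------------------------------------------------------------------

data Letter : Set where
  𝕩 𝕪 𝕫 α β : Letter

_≟ᴸ_ : DecidableEquality Letter
𝕩 ≟ᴸ 𝕩 = yes refl
𝕩 ≟ᴸ 𝕪 = no λ ()
𝕩 ≟ᴸ 𝕫 = no λ ()
𝕩 ≟ᴸ α = no λ ()
𝕩 ≟ᴸ β = no λ ()
𝕪 ≟ᴸ 𝕩 = no λ ()
𝕪 ≟ᴸ 𝕪 = yes refl
𝕪 ≟ᴸ 𝕫 = no λ ()
𝕪 ≟ᴸ α = no λ ()
𝕪 ≟ᴸ β = no λ ()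
𝕫 ≟ᴸ 𝕩 = no λ ()
𝕫 ≟ᴸ 𝕪 = no λ ()
𝕫 ≟ᴸ 𝕫 = yes refl
𝕫 ≟ᴸ α = no λ ()
𝕫 ≟ᴸ β = no λ ()
α ≟ᴸ 𝕩 = no λ ()
α ≟ᴸ 𝕪 = no λ ()
α ≟ᴸ 𝕫 = no λ ()
α ≟ᴸ α = yes refl
α ≟ᴸ β = no λ ()
β ≟ᴸ 𝕩 = no λ ()
β ≟ᴸ 𝕪 = no λ ()
β ≟ᴸ 𝕫 = no λ ()
β ≟ᴸ α = no λ ()
β ≟ᴸ β = yes refl

string : Subset m → Subset m → Vec Letter m
string X Y = tabulate λ i →
  if lookup X i then 𝕩 else if lookup Y i then 𝕪 else 𝕫

-- "d′ is the string d′₁…d′ₘ obtained from d = d₁…dₘ."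
Primed : Vec Letter m → Vec Letter m → Set
Primed {m} d d′ = ∀ i → let i-1 = i ⊕ (m ∸ 1) in
  (lookup d i ≡ 𝕩 ⊎ lookup d i ≡ 𝕪 → lookup d′ i ≡ lookup d i) ×
  (lookup d i ≡ 𝕫 →
    (lookup d′ i ≡ α ⊎ lookup d′ i ≡ β) ×
    lookup d′ i ≢ lookup d′ i-1 ×
    (lookup d i-1 ≡ 𝕩 → lookup d′ i ≡ β) ×
    (lookup d i-1 ≡ 𝕪 → lookup d′ i ≡ α))

-- Only meaningful when X and Y are disjoint and not both empty; then exactly
-- one d′ satisfies Primed (string X Y) d′.
sgn : Subset m → Subset m → Pred Letter 0ℓ
sgn X Y e = (e ≡ α ⊎ e ≡ β) × ∃ λ d′ → Primed (string X Y) d′ × Odd (count (e ≟ᴸ_) d′)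

------------------------------------------------------------------------

C last : ∀ m → Subset m
C    m = comprehension λ j → ¬? (2 ∣? label j) ×-dec (label j ℕ.≤? m ∸ 2)
last m = comprehension λ j → label j ℕ.≟ m   -- {m}

A B : ∀ m → Subset (m + m)
A m = (last m ∪ (C m +ˢ 1)) ∪′ (C m +ˢ 1)
B m = (last m ∪ C m) ∪′ C m

-- The union over Q ∈ Ω is indexed by the pairs (X , Y) with Q = ⟨ X ∥ Y ⟩.
𝓗 : ∀ m → SetSystem (m + m)
𝓗 m T =
  orbit m (λ S → S ≡ A m ⊎ S ≡ B m) T ⊎
  ∃₂ λ (X Y : Subset m) →
    InΩ X Y ×
    ¬ (⟨ X ∥ Y ⟩ ≐ ⟨ C m ∥ C m +ˢ 1 ⟩) ×
    ¬ (⟨ X ∥ Y ⟩ ≐ ⟨ C m +ˢ 1 ∥ C m ⟩) ×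
    sgn X Y ≐ ｛ β ｝ ×
    ⟨ X ∥ Y ⟩ T

-- i = 1, 2 are zero, suc zero.
𝓕 : ∀ m → Fin 2 → SetSystem (m + m)
𝓕 m zero       = 𝓕₁ m
𝓕 m (suc zero) = 𝓕₂ m

𝓢-blocks : ∀ m → Fin 2 → SetSystem (m + m)
𝓢-blocks m i T = 𝓗 m T ⊎ 𝓕 m i T

------------------------------------------------------------------------

module Decidability where

  _≟ˢ_ : DecidableEquality (Subset n)
  _≟ˢ_ = ≡-dec Bool._≟_

  ≐-decˢ : {P Q : SetSystem n} → Decidable P → Decidable Q → Dec (P ≐ Q)
  ≐-decˢ P? Q? = ⊆-dec P? Q? ×-dec ⊆-dec Q? P?
    where
    ⊆-dec : {P Q : SetSystem n} → Decidable P → Decidable Q →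
            Dec (∀ {S} → P S → Q S)
    ⊆-dec P? Q? = map′
      (λ ∄S {S} p → decidable-stable (Q? S) λ ¬q → ∄S (S , p , ¬q))
      (λ P⊆Q (S , p , ¬q) → ¬q (P⊆Q p))
      (¬? (anySubset? λ S → P? S ×-dec ¬? (Q? S)))

  anyLetter? : {P : Pred Letter 0ℓ} → Decidable P → Dec (∃ P)
  anyLetter? P? = map′
    (λ { (inj₁ p) → 𝕩 , p
       ; (inj₂ (inj₁ p)) → 𝕪 , p
       ; (inj₂ (inj₂ (inj₁ p))) → 𝕫 , p
       ; (inj₂ (inj₂ (inj₂ (inj₁ p)))) → α , p
       ; (inj₂ (inj₂ (inj₂ (inj₂ p)))) → β , p })
    (λ { (𝕩 , p) → inj₁ p
       ; (𝕪 , p) → inj₂ (inj₁ p)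
       ; (𝕫 , p) → inj₂ (inj₂ (inj₁ p))
       ; (α , p) → inj₂ (inj₂ (inj₂ (inj₁ p)))
       ; (β , p) → inj₂ (inj₂ (inj₂ (inj₂ p))) })
    (P? 𝕩 ⊎-dec P? 𝕪 ⊎-dec P? 𝕫 ⊎-dec P? α ⊎-dec P? β)

  anyString? : {P : Pred (Vec Letter n) 0ℓ} → Decidable P → Dec (∃ P)
  anyString? {n = zero}  P? = map′ (λ p → [] , p) (λ { ([] , p) → p }) (P? [])
  anyString? {n = suc n} P? = map′
    (λ (e , w , p) → e ∷ w , p) (λ { (e ∷ w , p) → e , w , p })
    (anyLetter? λ e → anyString? λ w → P? (e ∷ w))

  ≐-decᴸ : {P Q : Pred Letter 0ℓ} → Decidable P → Decidable Q → Dec (P ≐ Q)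
  ≐-decᴸ P? Q? = ⊆-dec P? Q? ×-dec ⊆-dec Q? P?
    where
    ⊆-dec : {P Q : Pred Letter 0ℓ} → Decidable P → Decidable Q →
            Dec (∀ {e} → P e → Q e)
    ⊆-dec P? Q? = map′
      (λ ∄e {e} p → decidable-stable (Q? e) λ ¬q → ∄e (e , p , ¬q))
      (λ P⊆Q (e , p , ¬q) → ¬q (P⊆Q p))
      (¬? (anyLetter? λ e → P? e ×-dec ¬? (Q? e)))

  orbit? : ∀ m {𝒜 : SetSystem (m + m)} → Decidable 𝒜 → Decidable (orbit m 𝒜)
  orbit? m 𝒜? T = any? λ i → anySubset? λ S → 𝒜? S ×-dec (T ≟ˢ _)

  [_∥_]? : (X Y : Subset m) → Decidable [ X ∥ Y ]
  [ X ∥ Y ]? J = all? λ j →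
    ((j ∈? X) →-dec (_ ℕ.≟ 2)) ×-dec
    ((j ∈? Y) →-dec (_ ℕ.≟ 0)) ×-dec
    ((¬? (j ∈? X) ×-dec ¬? (j ∈? Y)) →-dec (_ ℕ.≟ 1))

  ⟨_∥_⟩? : (X Y : Subset m) → Decidable ⟨ X ∥ Y ⟩
  ⟨_∥_⟩? {m} X Y = orbit? m [ X ∥ Y ]?

  inΩ? : (X Y : Subset m) → Dec (InΩ X Y)
  inΩ? {m} X Y = (∣ X ∣ ℕ.≟ ∣ Y ∣) ×-dec ¬? (nonempty? (X ∩ Y)) ×-dec
    ¬? (≐-decˢ ⟨ X ∥ Y ⟩? ⟨ ∅ {m} ∥ ∅ ⟩?)

  primed? : (d d′ : Vec Letter m) → Dec (Primed d d′)
  primed? d d′ = all? λ i →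
    (((_ ≟ᴸ 𝕩) ⊎-dec (_ ≟ᴸ 𝕪)) →-dec (_ ≟ᴸ _)) ×-dec
    ((_ ≟ᴸ 𝕫) →-dec
      ((_ ≟ᴸ α) ⊎-dec (_ ≟ᴸ β)) ×-dec
      ¬? (_ ≟ᴸ _) ×-dec
      ((_ ≟ᴸ 𝕩) →-dec (_ ≟ᴸ β)) ×-dec
      ((_ ≟ᴸ 𝕪) →-dec (_ ≟ᴸ α)))

  sgn? : (X Y : Subset m) → Decidable (sgn X Y)
  sgn? X Y e = ((e ≟ᴸ α) ⊎-dec (e ≟ᴸ β)) ×-dec anyString? λ d′ →
    primed? (string X Y) d′ ×-dec ¬? (2 ∣? count (e ≟ᴸ_) d′)

  𝓗? : ∀ m → Decidable (𝓗 m)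
  𝓗? m T =
    orbit? m (λ S → (S ≟ˢ A m) ⊎-dec (S ≟ˢ B m)) T ⊎-dec
    (anySubset? λ X → anySubset? λ Y →
      inΩ? X Y ×-dec
      ¬? (≐-decˢ ⟨ X ∥ Y ⟩? ⟨ C m ∥ C m +ˢ 1 ⟩?) ×-dec
      ¬? (≐-decˢ ⟨ X ∥ Y ⟩? ⟨ C m +ˢ 1 ∥ C m ⟩?) ×-dec
      ≐-decᴸ (sgn? X Y) (β ≟ᴸ_) ×-dec
      ⟨ X ∥ Y ⟩? T)

  𝓕? : ∀ m i → Decidable (𝓕 m i)
  𝓕? m zero       T = anySubset? λ J → ¬? (2 ∣? ∣ J ∣) ×-dec (T ≟ˢ F J)
  𝓕? m (suc zero) T = anySubset? λ J → (2 ∣? ∣ J ∣) ×-dec (T ≟ˢ F J)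

-- The Sperner property holds because every block has exactly m elements.
module BlockSize where

  ∈-comprehension⁺ : {P : Pred (Fin n) 0ℓ} (P? : Decidable P) →
                     ∀ {i} → P i → i ∈ comprehension P?
  ∈-comprehension⁺ P? {i} p = lookup⇒[]= i _
    (trans (lookup∘tabulate _ i) (dec-true (P? i) p))

  ∈-comprehension⁻ : {P : Pred (Fin n) 0ℓ} (P? : Decidable P) →
                     ∀ {i} → i ∈ comprehension P? → P i
  ∈-comprehension⁻ P? {i} i∈ = decidable-stable (P? i) λ ¬p →
    case (trans (sym ([]=⇒lookup i∈)) (trans (lookup∘tabulate _ i) (dec-false (P? i) ¬p)))
    where
    case : true ≡ false → _
    case ()

  ∈-image⁺ : (f : Fin k → Fin n) (S : Subset k) → ∀ {j} → j ∈ S → f j ∈ image f S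
  ∈-image⁺ f S j∈S = ∈-comprehension⁺ (λ i → any? (λ j → (j ∈? S) ×-dec (f j Fin.≟ i))) (_ , j∈S , refl)

  ∈-image⁻ : (f : Fin k → Fin n) (S : Subset k) →
             ∀ {i} → i ∈ image f S → ∃ λ j → j ∈ S × f j ≡ i
  ∈-image⁻ f S = ∈-comprehension⁻ (λ i → any? (λ j → (j ∈? S) ×-dec (f j Fin.≟ i)))

  bit : Bool → ℕ
  bit b = if b then 1 else 0

  ∣∷∣ : ∀ b (S : Subset n) → ∣ b ∷ S ∣ ≡ bit b + ∣ S ∣
  ∣∷∣ true  S = refl
  ∣∷∣ false S = refl

  ∣++∣ : (S : Subset k) (T : Subset n) → ∣ S ++ T ∣ ≡ ∣ S ∣ + ∣ T ∣
  ∣++∣ []          T = refl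
  ∣++∣ (true  ∷ S) T = cong suc (∣++∣ S T)
  ∣++∣ (false ∷ S) T = ∣++∣ S T

  ∣∅∣ : ∀ n → ∣ ∅ {n} ∣ ≡ 0
  ∣∅∣ zero    = refl
  ∣∅∣ (suc n) = ∣∅∣ n

  ∣∅∩∣ : (S : Subset n) → ∣ ∅ ∩ S ∣ ≡ 0
  ∣∅∩∣ []      = refl
  ∣∅∩∣ (_ ∷ S) = ∣∅∩∣ S

  ∣⁅⁆∩∣ : ∀ j (S : Subset n) → ∣ ⁅ j ⁆ ∩ S ∣ ≡ bit (lookup S j)
  ∣⁅⁆∩∣ zero    (true  ∷ S) = cong suc (∣∅∩∣ S)
  ∣⁅⁆∩∣ zero    (false ∷ S) = ∣∅∩∣ S
  ∣⁅⁆∩∣ (suc j) (_ ∷ S)     = ∣⁅⁆∩∣ j S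

  ∣⁅⁆∪∣ : ∀ j (S : Subset n) → j ∉ S → ∣ ⁅ j ⁆ ∪ S ∣ ≡ suc ∣ S ∣
  ∣⁅⁆∪∣ zero    (true  ∷ S) j∉S = contradiction (lookup⇒[]= zero _ refl) j∉S
  ∣⁅⁆∪∣ zero    (false ∷ S) j∉S = cong (suc ∘ ∣_∣) (Subset.∪-identityˡ S)
  ∣⁅⁆∪∣ (suc j) (true  ∷ S) j∉S = cong suc (∣⁅⁆∪∣ j S (j∉S ∘ Vec.there))
  ∣⁅⁆∪∣ (suc j) (false ∷ S) j∉S = ∣⁅⁆∪∣ j S (j∉S ∘ Vec.there)

  ∣image∣ : (f : Fin k → Fin n) → (∀ {i j} → f i ≡ f j → i ≡ j) →
            ∀ S → ∣ image f S ∣ ≡ ∣ S ∣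
  ∣image∣ {n = n} f inj [] = trans (cong ∣_∣ eq) (∣∅∣ n)
    where
    eq : image f [] ≡ ∅
    eq = Subset.⊆-antisym
      (λ i∈ → case (∈-image⁻ f [] i∈)) (λ i∈ → contradiction i∈ Subset.∉⊥)
      where
      case : ∀ {i} → ∃ (λ j → j ∈ [] × f j ≡ i) → i ∈ ∅
      case ()
  ∣image∣ f inj (false ∷ S) = trans (cong ∣_∣ eq) (∣image∣ (f ∘ suc) (Fin.suc-injective ∘ inj) S)
    where
    to : ∀ {i} → ∃ (λ j → j ∈ (false ∷ S) × f j ≡ i) → i ∈ image (f ∘ suc) S
    to (suc j , Vec.there j∈S , refl) = ∈-image⁺ (f ∘ suc) S j∈S
    from : ∀ {i} → ∃ (λ j → j ∈ S × f (suc j) ≡ i) → i ∈ image f (false ∷ S)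
    from (j , j∈S , refl) = ∈-image⁺ f (false ∷ S) (Vec.there j∈S)
    eq : image f (false ∷ S) ≡ image (f ∘ suc) S
    eq = Subset.⊆-antisym (to ∘ ∈-image⁻ f (false ∷ S)) (from ∘ ∈-image⁻ (f ∘ suc) S)
  ∣image∣ f inj (true ∷ S) = trans (cong ∣_∣ eq)
    (trans (∣⁅⁆∪∣ (f zero) _ f0∉) (cong suc (∣image∣ (f ∘ suc) (Fin.suc-injective ∘ inj) S)))
    where
    f0∉ : f zero ∉ image (f ∘ suc) S
    f0∉ f0∈ with _ , _ , e ← ∈-image⁻ (f ∘ suc) S f0∈ with () ← inj e
    to : ∀ {i} → ∃ (λ j → j ∈ (true ∷ S) × f j ≡ i) → i ∈ ⁅ f zero ⁆ ∪ image (f ∘ suc) S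
    to (zero  , _ , refl)             = Subset.x∈p∪q⁺ (inj₁ (Subset.x∈⁅x⁆ _))
    to (suc j , Vec.there j∈S , refl) = Subset.x∈p∪q⁺ (inj₂ (∈-image⁺ (f ∘ suc) S j∈S))
    from : ∀ {i} → i ∈ ⁅ f zero ⁆ ⊎ i ∈ image (f ∘ suc) S → i ∈ image f (true ∷ S)
    from (inj₁ i∈) rewrite Subset.x∈⁅y⁆⇒x≡y _ i∈ = ∈-image⁺ f (true ∷ S) Vec.here
    from (inj₂ i∈) with _ , j∈S , refl ← ∈-image⁻ (f ∘ suc) S i∈ =
      ∈-image⁺ f (true ∷ S) (Vec.there j∈S)
    eq : image f (true ∷ S) ≡ ⁅ f zero ⁆ ∪ image (f ∘ suc) S
    eq = Subset.⊆-antisym (to ∘ ∈-image⁻ f (true ∷ S)) (from ∘ Subset.x∈p∪q⁻ _ _)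

  toℕ-⊕ : (i : Fin (suc m)) (q : ℕ) → toℕ (i ⊕ q) ≡ (toℕ i + q) % suc m
  toℕ-⊕ {m} i q = toℕ-fromℕ< (m%n<n (toℕ i + q) (suc m))

  ⊕1⊕pred : (i : Fin (suc m)) → (i ⊕ 1) ⊕ m ≡ i
  ⊕1⊕pred {m} i = toℕ-injective (begin
    toℕ ((i ⊕ 1) ⊕ m)                              ≡⟨ toℕ-⊕ (i ⊕ 1) m ⟩
    (toℕ (i ⊕ 1) + m) % suc m                      ≡⟨ cong (λ t → (t + m) % suc m) (toℕ-⊕ i 1) ⟩
    ((toℕ i + 1) % suc m + m) % suc m              ≡⟨ cong (λ t → ((toℕ i + 1) % suc m + t) % suc m) (m<n⇒m%n≡m (ℕ.n<1+n m)) ⟨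
    ((toℕ i + 1) % suc m + m % suc m) % suc m      ≡⟨ %-distribˡ-+ (toℕ i + 1) m (suc m) ⟨
    (toℕ i + 1 + m) % suc m                        ≡⟨ cong (_% suc m) (ℕ.+-assoc (toℕ i) 1 m) ⟩
    (toℕ i + suc m) % suc m                        ≡⟨ [m+n]%n≡m%n (toℕ i) (suc m) ⟩
    toℕ i % suc m                                  ≡⟨ m<n⇒m%n≡m (toℕ<n i) ⟩
    toℕ i                                          ∎)
    where open ≡-Reasoning

  label-⊕1 : (j : Fin m) → label j < m → label (j ⊕ 1) ≡ suc (label j)
  label-⊕1 {m = suc m} j lt = cong suc (trans (toℕ-⊕ j 1)
    (trans (cong (_% suc m) (ℕ.+-comm (toℕ j) 1)) (m<n⇒m%n≡m lt)))

  ⊕1-injective : {i j : Fin m} → i ⊕ 1 ≡ j ⊕ 1 → i ≡ j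
  ⊕1-injective {m = suc m} {i} {j} e =
    trans (sym (⊕1⊕pred i)) (trans (cong (_⊕ m) e) (⊕1⊕pred j))

  ρ-injective : ∀ m {d e : E m} → ρ m d ≡ ρ m e → d ≡ e
  ρ-injective m {d} {e} eq =
    trans (sym (Fin.join-splitAt m m d)) (trans (cong (join m m) s≡s) (Fin.join-splitAt m m e))
    where
    map-injective : (a b : Fin m ⊎ Fin m) →
      Sum.map (_⊕ 1) (_⊕ 1) a ≡ Sum.map (_⊕ 1) (_⊕ 1) b → a ≡ b
    map-injective (inj₁ _) (inj₁ _) p = cong inj₁ (⊕1-injective (Sum.inj₁-injective p))
    map-injective (inj₂ _) (inj₂ _) p = cong inj₂ (⊕1-injective (Sum.inj₂-injective p))
    map-injective (inj₁ _) (inj₂ _) ()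
    map-injective (inj₂ _) (inj₁ _) ()
    s≡s : splitAt m d ≡ splitAt m e
    s≡s = map-injective _ _ (trans (sym (Fin.splitAt-join m m _))
      (trans (cong (splitAt m) eq) (Fin.splitAt-join m m _)))

  ρ^-injective : ∀ m q {d e : E m} → iterate (ρ m) d q ≡ iterate (ρ m) e q → d ≡ e
  ρ^-injective m zero    eq = eq
  ρ^-injective m (suc q) eq = ρ-injective m (ρ^-injective m q eq)

  ∣orbit∣ : ∀ m {𝒜 : SetSystem (m + m)} → (∀ {S} → 𝒜 S → ∣ S ∣ ≡ m) →
         ∀ {T} → orbit m 𝒜 T → ∣ T ∣ ≡ m
  ∣orbit∣ m size (i , S , a , refl) =
    trans (∣image∣ _ (ρ^-injective m (label i)) S) (size a)

  balanced-size : (X Y P Q : Subset m) →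
    (∀ j → bit (lookup P j) + bit (lookup Q j) + bit (lookup Y j) ≡ suc (bit (lookup X j))) →
    ∣ P ∣ + ∣ Q ∣ + ∣ Y ∣ ≡ m + ∣ X ∣
  balanced-size [] [] [] [] h = refl
  balanced-size {m = suc m} (a ∷ X) (b ∷ Y) (p ∷ P) (q ∷ Q) h = begin
    ∣ p ∷ P ∣ + ∣ q ∷ Q ∣ + ∣ b ∷ Y ∣
      ≡⟨ cong₂ _+_ (cong₂ _+_ (∣∷∣ p P) (∣∷∣ q Q)) (∣∷∣ b Y) ⟩
    (bit p + ∣ P ∣) + (bit q + ∣ Q ∣) + (bit b + ∣ Y ∣)
      ≡⟨ solve 6 (λ p q b s t u → (p :+ s) :+ (q :+ t) :+ (b :+ u) := (p :+ q :+ b) :+ (s :+ t :+ u))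
           refl (bit p) (bit q) (bit b) (∣ P ∣) (∣ Q ∣) (∣ Y ∣) ⟩
    (bit p + bit q + bit b) + (∣ P ∣ + ∣ Q ∣ + ∣ Y ∣)
      ≡⟨ cong₂ _+_ (h zero) (balanced-size X Y P Q (h ∘ suc)) ⟩
    suc (bit a) + (m + ∣ X ∣)
      ≡⟨ solve 3 (λ a m s → con 1 :+ a :+ (m :+ s) := con 1 :+ m :+ (a :+ s)) refl (bit a) m (∣ X ∣) ⟩
    suc m + (bit a + ∣ X ∣)
      ≡⟨ cong (suc m +_) (∣∷∣ a X) ⟨
    suc m + ∣ a ∷ X ∣ ∎
    where
    open ≡-Reasoning
    open +-*-Solver

  ∣∪′∣ : (X Y P Q : Subset m) → ∣ X ∣ ≡ ∣ Y ∣ →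
    (∀ j → bit (lookup P j) + bit (lookup Q j) + bit (lookup Y j) ≡ suc (bit (lookup X j))) →
    ∣ P ∪′ Q ∣ ≡ m
  ∣∪′∣ X Y P Q ∣X∣≡∣Y∣ h = ℕ.+-cancelʳ-≡ ∣ Y ∣ _ _
    (trans (cong (_+ ∣ Y ∣) (∣++∣ P Q)) (trans (balanced-size X Y P Q h) (cong (_ +_) ∣X∣≡∣Y∣)))

  lookup-∉ : (S : Subset n) → ∀ {j} → lookup S j ≡ false → j ∉ S
  lookup-∉ S e j∈S with () ← trans (sym e) ([]=⇒lookup j∈S)

  ∉-lookup : (S : Subset n) → ∀ {j} → j ∉ S → lookup S j ≡ false
  ∉-lookup S {j} j∉S with lookup S j in e
  ... | true  = contradiction (lookup⇒[]= j S e) j∉S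
  ... | false = refl

  ∣[∥]∣ : (X Y : Subset m) → ∣ X ∣ ≡ ∣ Y ∣ → Disjoint X Y →
          ∀ {J} → [ X ∥ Y ] J → ∣ J ∣ ≡ m
  ∣[∥]∣ {m} X Y ∣X∣≡∣Y∣ disj {J} h with P , Q , refl ← Vec.splitAt m J =
    ∣∪′∣ X Y P Q ∣X∣≡∣Y∣ balance
    where
    pair : ∀ j → ∣ (⁅ j ⁆ ∪′ ⁅ j ⁆) ∩ (P ++ Q) ∣ ≡ bit (lookup P j) + bit (lookup Q j)
    pair j = begin
      ∣ (⁅ j ⁆ ++ ⁅ j ⁆) ∩ (P ++ Q) ∣        ≡⟨ cong ∣_∣ (zipWith-++ _ ⁅ j ⁆ ⁅ j ⁆ P Q) ⟩
      ∣ (⁅ j ⁆ ∩ P) ++ (⁅ j ⁆ ∩ Q) ∣         ≡⟨ ∣++∣ (⁅ j ⁆ ∩ P) (⁅ j ⁆ ∩ Q) ⟩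
      ∣ ⁅ j ⁆ ∩ P ∣ + ∣ ⁅ j ⁆ ∩ Q ∣          ≡⟨ cong₂ _+_ (∣⁅⁆∩∣ j P) (∣⁅⁆∩∣ j Q) ⟩
      bit (lookup P j) + bit (lookup Q j)    ∎
      where open ≡-Reasoning
    balance : ∀ j → bit (lookup P j) + bit (lookup Q j) + bit (lookup Y j) ≡ suc (bit (lookup X j))
    balance j with lookup X j in ex | lookup Y j in ey | h j
    ... | true  | true  | _ = contradiction
      (j , Subset.x∈p∩q⁺ (lookup⇒[]= j X ex , lookup⇒[]= j Y ey)) disj
    ... | true  | false | h₂ , _ , _ =
      cong (_+ 0) (trans (sym (pair j)) (h₂ (lookup⇒[]= j X ex)))
    ... | false | true  | _ , h₀ , _ =
      cong (_+ 1) (trans (sym (pair j)) (h₀ (lookup⇒[]= j Y ey)))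
    ... | false | false | _ , _ , h₁ =
      cong (_+ 0) (trans (sym (pair j)) (h₁ (lookup-∉ X ex , lookup-∉ Y ey)))

  ∣F∣ : (J : Subset m) → ∣ F J ∣ ≡ m
  ∣F∣ J = ∣∪′∣ ∅ ∅ J (∁ J) refl balance
    where
    balance : ∀ j → bit (lookup J j) + bit (lookup (∁ J) j) + bit (lookup ∅ j) ≡ suc (bit (lookup ∅ j))
    balance j rewrite lookup-map j not J | Vec.lookup-replicate j false with lookup J j
    ... | true  = refl
    ... | false = refl

  -- For odd m, the set [m] is partitioned into C, C + 1 and {m}.
  module _ (m-odd : Odd m) where

    data Part (j : Fin m) : Set where
      inC   : lookup (C m) j ≡ true  → lookup (C m +ˢ 1) j ≡ false → lookup (last m) j ≡ false → Part j
      inC+1 : lookup (C m) j ≡ false → lookup (C m +ˢ 1) j ≡ true  → lookup (last m) j ≡ false → Part j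
      isM   : lookup (C m) j ≡ false → lookup (C m +ˢ 1) j ≡ false → lookup (last m) j ≡ true  → Part j

    even+1 : ∀ {n} → 2 ∣ n → Odd (suc n)
    even+1 {n} 2∣n 2∣1+n with () ← ∣1⇒≡1 (∣m+n∣m⇒∣n (subst (2 ∣_) (ℕ.+-comm 1 n) 2∣1+n) 2∣n)

    odd+1 : ∀ n → Odd n → 2 ∣ suc n
    odd+1 zero          odd = contradiction (2 ∣0) odd
    odd+1 (suc zero)    odd = ∣-refl
    odd+1 (suc (suc n)) odd = ∣m∣n⇒∣m+n ∣-refl (odd+1 n λ 2∣n → odd (∣m∣n⇒∣m+n ∣-refl 2∣n))

    C⁻ : ∀ {j : Fin m} → j ∈ C m → Odd (label j) × label j ≤ m ∸ 2
    C⁻ = ∈-comprehension⁻ λ j → ¬? (2 ∣? label j) ×-dec (label j ℕ.≤? m ∸ 2)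

    C⁺ : ∀ {j : Fin m} → Odd (label j) → label j ≤ m ∸ 2 → j ∈ C m
    C⁺ odd le = ∈-comprehension⁺ (λ j → ¬? (2 ∣? label j) ×-dec (label j ℕ.≤? m ∸ 2)) (odd , le)

    last⁻ : ∀ {j : Fin m} → j ∈ last m → label j ≡ m
    last⁻ = ∈-comprehension⁻ λ j → label j ℕ.≟ m

    ∸2 : ∀ {l n} → suc l ≤ n ∸ 2 → suc (suc (suc l)) ≤ n
    ∸2 {n = suc (suc n)} le = s≤s (s≤s le)

    C+1⁻ : ∀ {j : Fin m} → j ∈ C m +ˢ 1 → 2 ∣ label j × label j < m
    C+1⁻ j∈ with i , i∈ , refl ← ∈-image⁻ (_⊕ 1) (C m) j∈ with odd , le ← C⁻ i∈
      rewrite label-⊕1 i (ℕ.<-trans (ℕ.n<1+n _) (∸2 le)) = odd+1 _ odd , ∸2 le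

    C+1⁺ : ∀ {j : Fin m} → 2 ∣ label j → label j < m → j ∈ C m +ˢ 1
    C+1⁺ {zero}  2∣1 _  with () ← ∣1⇒≡1 2∣1
    C+1⁺ {suc j} 2∣  lt = subst (_∈ C m +ˢ 1) i+1≡j (∈-image⁺ (_⊕ 1) (C m) i∈C)
      where
      i = inject₁ j
      label-i : label i ≡ suc (toℕ j)
      label-i = cong suc (Fin.toℕ-inject₁ j)
      i∈C : i ∈ C m
      i∈C = C⁺ (subst Odd (sym label-i) (λ 2∣′ → even+1 2∣′ 2∣))
        (subst (_≤ m ∸ 2) (sym label-i) (ℕ.∸-monoˡ-≤ 2 lt))
      i+1≡j : i ⊕ 1 ≡ suc j
      i+1≡j = toℕ-injective (ℕ.suc-injective (trans
        (label-⊕1 i (subst (_< m) (sym label-i) (ℕ.<-trans (ℕ.n<1+n _) lt))) (cong suc label-i)))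

    part : ∀ j → Part j
    part j with label j ℕ.≟ m
    ... | yes l≡m = isM
      (∉-lookup (C m) λ j∈ → ℕ.<⇒≢ (ℕ.<-trans (ℕ.n<1+n _) (∸2 (proj₂ (C⁻ j∈)))) l≡m)
      (∉-lookup (C m +ˢ 1) λ j∈ → ℕ.<⇒≢ (proj₂ (C+1⁻ j∈)) l≡m)
      ([]=⇒lookup (∈-comprehension⁺ (λ j → label j ℕ.≟ m) l≡m))
    ... | no l≢m with 2 ∣? label j
    ...   | yes 2∣l = inC+1
      (∉-lookup (C m) λ j∈ → proj₁ (C⁻ j∈) 2∣l)
      ([]=⇒lookup (C+1⁺ 2∣l l<m))
      (∉-lookup (last m) λ j∈ → l≢m (last⁻ j∈))
      where l<m = ℕ.≤∧≢⇒< (toℕ<n j) l≢m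
    ...   | no odd = inC
      ([]=⇒lookup (C⁺ odd (ℕ.∸-monoˡ-≤ 2 l+1<m)))
      (∉-lookup (C m +ˢ 1) λ j∈ → odd (proj₁ (C+1⁻ j∈)))
      (∉-lookup (last m) λ j∈ → l≢m (last⁻ j∈))
      where
      l+1<m : suc (label j) < m
      l+1<m = ℕ.≤∧≢⇒< (ℕ.≤∧≢⇒< (toℕ<n j) l≢m) λ e → m-odd (subst (2 ∣_) e (odd+1 _ odd))

    ∣C+1∣ : ∣ C m +ˢ 1 ∣ ≡ ∣ C m ∣
    ∣C+1∣ = ∣image∣ (_⊕ 1) ⊕1-injective (C m)

    ∣A∣ : ∣ A m ∣ ≡ m
    ∣A∣ = ∣∪′∣ (C m +ˢ 1) (C m) (last m ∪ (C m +ˢ 1)) (C m +ˢ 1) ∣C+1∣ balance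
      where
      balance : ∀ j → bit (lookup (last m ∪ (C m +ˢ 1)) j) + bit (lookup (C m +ˢ 1) j)
                      + bit (lookup (C m) j) ≡ suc (bit (lookup (C m +ˢ 1) j))
      balance j rewrite lookup-zipWith _∨_ j (last m) (C m +ˢ 1) with part j
      ... | inC   p q r rewrite p | q | r = refl
      ... | inC+1 p q r rewrite p | q | r = refl
      ... | isM   p q r rewrite p | q | r = refl

    ∣B∣ : ∣ B m ∣ ≡ m
    ∣B∣ = ∣∪′∣ (C m) (C m +ˢ 1) (last m ∪ C m) (C m) (sym ∣C+1∣) balance
      where
      balance : ∀ j → bit (lookup (last m ∪ C m) j) + bit (lookup (C m) j)
                      + bit (lookup (C m +ˢ 1) j) ≡ suc (bit (lookup (C m) j))
      balance j rewrite lookup-zipWith _∨_ j (last m) (C m) with part j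
      ... | inC   p q r rewrite p | q | r = refl
      ... | inC+1 p q r rewrite p | q | r = refl
      ... | isM   p q r rewrite p | q | r = refl

open BlockSize

𝓢-size : Odd m → ∀ i {T} → 𝓢-blocks m i T → ∣ T ∣ ≡ m
𝓢-size {m} odd i (inj₁ (inj₁ t)) =
  ∣orbit∣ m (λ { (inj₁ refl) → ∣A∣ odd ; (inj₂ refl) → ∣B∣ odd }) t
𝓢-size {m} odd i (inj₁ (inj₂ (X , Y , (∣X∣≡∣Y∣ , disj , _) , _ , _ , _ , t))) =
  ∣orbit∣ m {𝒜 = [ X ∥ Y ]} (λ {S} → ∣[∥]∣ X Y ∣X∣≡∣Y∣ disj {S}) t
𝓢-size odd zero       (inj₂ (J , _ , refl)) = ∣F∣ J
𝓢-size odd (suc zero) (inj₂ (J , _ , refl)) = ∣F∣ J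

open Decidability

𝓢 : ∀ m → Odd m → Fin 2 → SpernerSystem (m + m)
𝓢 m odd i = record
  { Block   = 𝓢-blocks m i
  ; block?  = λ T → 𝓗? m T ⊎-dec 𝓕? m i T
  ; sperner = λ {S} {T} s t S⊆T → Subset.⊆-antisym S⊆T λ {e} e∈T →
      decidable-stable (e ∈? S) λ e∉S → ℕ.<-irrefl
        (trans (𝓢-size odd i s) (sym (𝓢-size odd i t)))
        (p⊂q⇒∣p∣<∣q∣ (S⊆T , e , e∈T , e∉S))
  }

{-# OPTIONS --safe #-}

-- Write x, y, z (full, empty, half) for the positions j at which a set T
-- contains both, none or one of j and j′. This turns T into a cyclic word, and
-- T has more (fewer) than m elements exactly if x occurs more (less) often than
-- y. A cyclic word with some x or y has a unique state function, telling for
-- each position whether a z there would become β or α; complementation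
-- exchanges x with y and α with β.
--
-- If |T| = m, exactly one of T and its complement is a block: if all letters
-- are z, then T = F_J and the parity of |J| decides; if T is a rotation of
-- xyxy…xyz or yxyx…yxz, exactly one of the two has an unprimed element at its
-- only z; otherwise the number of z's is odd and exactly one of the two has
-- sign β.
--
-- If |T| > m, it remains to find a block in T, where |T| = m + 1 may be
-- assumed. Removing an element turns an x into z or a z into y. Such a move
-- affects the state only just after the moved letter, so its effect on the
-- number of β's can be read off locally. If no move gave the right parity,
-- then in the even case each x would be preceded by y, although there are more
-- x's than y's, and in the odd case all letters would be x.

module Submission where

open import Defs
open import Data.Bool.Base using (Bool; true; false; not; _∨_; if_then_else_)
open import Data.Bool.Properties using (not-involutive) renaming (_≟_ to _≟ᵇ_)
open import Data.Empty using (⊥)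
open import Data.Fin.Base using (Fin; zero; suc; toℕ; fromℕ; punchIn; _↑ˡ_; _↑ʳ_; splitAt; join)
open import Data.Fin.Permutation using (permutation)
open import Data.Fin.Properties
  using (toℕ-injective; toℕ<n; toℕ-fromℕ; toℕ-fromℕ<; any?; all?; punchInᵢ≢i;
         splitAt-↑ˡ; splitAt-↑ʳ; join-splitAt; ↑ˡ-injective; ↑ʳ-injective)
  renaming (_≟_ to _≟ᶠ_)
open import Data.Fin.Subset using (Subset; _∈_; _∉_; _⊆_; ⁅_⁆; ∁; _∩_; _∪_; ∣_∣)
  renaming (⊥ to ∅)
open import Data.Fin.Subset.Properties
  using (anySubset?; _∈?_; ∉⊥; x∈p∩q⁺; x∈p∩q⁻; p⊂q⇒∣p∣<∣q∣; p⊆q⇒∣p∣≤∣q∣; ⊆-antisym)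
open import Data.Nat.Base using (ℕ; zero; suc; _+_; _∸_; _*_; _≤_; _<_; z≤n; s≤s)
open import Data.Nat.Divisibility
  using (_∣_; _∣?_; _∣0; ∣-refl; ∣1⇒≡1; m∣m*n; ∣m+n∣m⇒∣n; ∣m∣n⇒∣m+n)
open import Data.Nat.DivMod
  using (_%_; _mod_; m%n<n; %-distribˡ-+; [m+kn]%n≡m%n; m<n⇒m%n≡m; m%n%n≡m%n; n%n≡0)
open import Data.Nat.GeneralisedArithmetic using (iterate)
import Data.Nat.Properties as ℕ
open import Data.Nat.Solver using (module +-*-Solver)
open import Data.Product.Base using (∃; ∃₂; _×_; _,_; proj₁; proj₂)
open import Data.Sum.Base as Sum using (_⊎_; inj₁; inj₂; [_,_]′)
open import Data.Vec.Base as Vec using (Vec; []; _∷_; _++_; lookup; tabulate; count; _[_]≔_)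
open import Data.Vec.Functional using (updateAt)
open import Data.Vec.Functional.Properties using (updateAt-updates; updateAt-minimal)
open import Data.Vec.Properties
  using (lookup∘tabulate; tabulate∘lookup; tabulate-cong; lookup-++ˡ; lookup-++ʳ;
         lookup-zipWith; zipWith-++; lookup-map; []=⇒lookup; lookup⇒[]=;
         lookup∘update; lookup∘update′)
open import Function.Base using (_∘_; id; const; case_of_)
open import Level using (0ℓ)
open import Relation.Binary.Definitions using (DecidableEquality; tri<; tri≈; tri>)
open import Relation.Binary.PropositionalEquality
  using (_≡_; _≢_; _≗_; refl; sym; trans; cong; cong₂; subst; module ≡-Reasoning)
open import Relation.Nullary using (¬_; Dec; yes; no; does; ¬?; contradiction)
open import Relation.Nullary.Decidable
  using (_×-dec_; _⊎-dec_; _→-dec_; decidable-stable; dec-false)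
open import Relation.Unary using (Pred; _≐_; ｛_｝)

open import Algebra.Properties.CommutativeMonoid.Sum ℕ.+-0-commutativeMonoid
  using (sum; sum-remove; sum-cong-≗; sum-replicate-zero; ∑-distrib-+; sum-permute)
open BlockSize

private
  variable
    n : ℕ

-- Sums over positions, and parity

sum-mono : (f g : Fin n → ℕ) → (∀ j → f j ≤ g j) → sum f ≤ sum g
sum-mono {zero}  f g f≤g = z≤n
sum-mono {suc n} f g f≤g = ℕ.+-mono-≤ (f≤g zero) (sum-mono (f ∘ suc) (g ∘ suc) (f≤g ∘ suc))

-- Both sides are the common rest plus `f p` and `g p`; the crosswise form avoids subtraction.
sum-change : ∀ (f g : Fin (suc n) → ℕ) p → (∀ j → j ≢ p → f j ≡ g j) →
             sum f + g p ≡ sum g + f p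
sum-change f g p agree = begin
  sum f + g p                        ≡⟨ cong (_+ g p) (sum-remove f) ⟩
  f p + rest f + g p                 ≡⟨ cong (λ t → f p + t + g p)
                                             (sum-cong-≗ λ j → agree _ (punchInᵢ≢i p j)) ⟩
  f p + rest g + g p                 ≡⟨ solve 3 (λ a r b → a :+ r :+ b := b :+ r :+ a)
                                             refl (f p) (rest g) (g p) ⟩
  g p + rest g + f p                 ≡⟨ cong (_+ f p) (sum-remove g) ⟨
  sum g + f p                        ∎
  where
  open ≡-Reasoning
  open +-*-Solver
  rest : (Fin (suc _) → ℕ) → ℕ
  rest h = sum (h ∘ punchIn p)

#_ : (Fin n → Bool) → ℕ
# f = sum (bit ∘ f)

odd⇒even-suc : ∀ {a} → Odd a → 2 ∣ suc a
-- `odd+1` lives in a module over an odd number; the hypothesis itself serves as that parameter.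
odd⇒even-suc odd = odd+1 odd _ odd

even⇒odd-suc : ∀ {a} → 2 ∣ a → Odd (suc a)
even⇒odd-suc = even+1 {1} (λ 2∣1 → contradiction 2∣1 1-odd)
  where
  1-odd : Odd 1
  1-odd 2∣1 with () ← ∣1⇒≡1 2∣1

odd+odd : ∀ {a b} → Odd a → Odd b → 2 ∣ a + b
odd+odd {a} {b} odd-a odd-b = ∣m+n∣m⇒∣n {m = 2}
  (subst (2 ∣_) (cong suc (ℕ.+-suc a b)) (∣m∣n⇒∣m+n (odd⇒even-suc odd-a) (odd⇒even-suc odd-b)))
  ∣-refl

-- Rotations of Fin (suc n)

⊕-⊕ : ∀ (i : Fin (suc n)) a b → (i ⊕ a) ⊕ b ≡ i ⊕ (a + b)
⊕-⊕ {n} i a b = toℕ-injective (begin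
  toℕ ((i ⊕ a) ⊕ b)                      ≡⟨ toℕ-⊕ (i ⊕ a) b ⟩
  (toℕ (i ⊕ a) + b) % m                  ≡⟨ cong (λ t → (t + b) % m) (toℕ-⊕ i a) ⟩
  ((toℕ i + a) % m + b) % m              ≡⟨ %-distribˡ-+ ((toℕ i + a) % m) b m ⟩
  ((toℕ i + a) % m % m + b % m) % m      ≡⟨ cong (λ t → (t + b % m) % m) (m%n%n≡m%n (toℕ i + a) m) ⟩
  ((toℕ i + a) % m + b % m) % m          ≡⟨ %-distribˡ-+ (toℕ i + a) b m ⟨
  (toℕ i + a + b) % m                    ≡⟨ cong (_% m) (ℕ.+-assoc (toℕ i) a b) ⟩
  (toℕ i + (a + b)) % m                  ≡⟨ toℕ-⊕ i (a + b) ⟨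
  toℕ (i ⊕ (a + b))                      ∎)
  where
  open ≡-Reasoning
  m = suc n

⊕-multiple : ∀ (i : Fin (suc n)) k → i ⊕ (k * suc n) ≡ i
⊕-multiple {n} i k = toℕ-injective (begin
  toℕ (i ⊕ (k * suc n))          ≡⟨ toℕ-⊕ i (k * suc n) ⟩
  (toℕ i + k * suc n) % suc n    ≡⟨ [m+kn]%n≡m%n (toℕ i) k (suc n) ⟩
  toℕ i % suc n                  ≡⟨ m<n⇒m%n≡m (toℕ<n i) ⟩
  toℕ i                          ∎)
  where open ≡-Reasoning

-- Rotation by `q * n` undoes rotation by `q`, since `q + q * n` is the multiple `q * suc n` of the
-- length.
⊕-inverseʳ : ∀ (i : Fin (suc n)) q → (i ⊕ q) ⊕ (q * n) ≡ i
⊕-inverseʳ {n} i q = begin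
  (i ⊕ q) ⊕ (q * n)    ≡⟨ ⊕-⊕ i q (q * n) ⟩
  i ⊕ (q + q * n)      ≡⟨ cong (i ⊕_) (ℕ.*-suc q n) ⟨
  i ⊕ (q * suc n)      ≡⟨ ⊕-multiple i q ⟩
  i                    ∎
  where open ≡-Reasoning

⊕-comm : ∀ (i : Fin (suc n)) a b → (i ⊕ a) ⊕ b ≡ (i ⊕ b) ⊕ a
⊕-comm i a b = trans (⊕-⊕ i a b) (trans (cong (i ⊕_) (ℕ.+-comm a b)) (sym (⊕-⊕ i b a)))

⊕-inverseˡ : ∀ (i : Fin (suc n)) q → (i ⊕ (q * n)) ⊕ q ≡ i
⊕-inverseˡ {n} i q = trans (⊕-comm i (q * n) q) (⊕-inverseʳ i q)

next prev : Fin (suc n) → Fin (suc n)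
next     i = i ⊕ 1
prev {n} i = i ⊕ n

prev-next : (i : Fin (suc n)) → prev (next i) ≡ i
prev-next = ⊕1⊕pred

next-prev : (i : Fin (suc n)) → next (prev i) ≡ i
next-prev {n} i = trans (⊕-comm i n 1) (⊕1⊕pred i)

next-≢ : ∀ {i j : Fin (suc n)} → j ≢ i → next j ≢ next i
next-≢ ≢ e = ≢ (⊕1-injective e)

cyclic-induction : (P : Fin (suc n) → Set) → (∀ j → P j → P (next j)) →
                   ∀ i → P i → ∀ j → P j
cyclic-induction {n} P step i Pi j = subst P reach (iterated (n * toℕ i + toℕ j))
  where
  iterated : ∀ k → P (i ⊕ k)
  iterated zero    = subst P (sym (⊕-multiple i 0)) Pi
  iterated (suc k) = subst P (trans (⊕-⊕ i k 1) (cong (i ⊕_) (ℕ.+-comm k 1))) (step _ (iterated k))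
  -- The first `n * toℕ i` steps lead from `i` to `zero`, because `i + n * i` is a multiple of
  -- `suc n`; `toℕ j` more lead to `j`.
  reach : i ⊕ (n * toℕ i + toℕ j) ≡ j
  reach = toℕ-injective (begin
    toℕ (i ⊕ (n * toℕ i + toℕ j))              ≡⟨ toℕ-⊕ i _ ⟩
    (toℕ i + (n * toℕ i + toℕ j)) % suc n      ≡⟨ cong (_% suc n) (solve 3
      (λ i n j → i :+ (n :* i :+ j) := j :+ i :* (con 1 :+ n)) refl (toℕ i) n (toℕ j)) ⟩
    (toℕ j + toℕ i * suc n) % suc n            ≡⟨ [m+kn]%n≡m%n (toℕ j) (toℕ i) (suc n) ⟩
    toℕ j % suc n                              ≡⟨ m<n⇒m%n≡m (toℕ<n j) ⟩
    toℕ j                                      ∎)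
    where
    open ≡-Reasoning
    open +-*-Solver

-- Going round from a fixed position would never leave it, although there are at least two
-- positions.
next-≢-self : 1 ≤ n → (j : Fin (suc n)) → next j ≢ j
next-≢-self {suc n} _ j fixed = 0≢1 (trans (all-j zero) (sym (all-j (suc zero))))
  where
  all-j : ∀ i → i ≡ j
  all-j = cyclic-induction (_≡ j) (λ i e → trans (cong next e) fixed) j refl
  0≢1 : zero ≢ suc (zero {n})
  0≢1 ()

#-zero : {f : Fin n → Bool} → (∀ j → f j ≡ false) → # f ≡ 0
#-zero {n} none = trans (sum-cong-≗ λ j → cong bit (none j)) (sum-replicate-zero n)

#-rotate : ∀ (f : Fin (suc n) → Bool) q → # (λ j → f (j ⊕ q)) ≡ # f
#-rotate {n} f q = sym (sum-permute (bit ∘ f)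
  (permutation (_⊕ q) (_⊕ (q * n)) (λ j → ⊕-inverseˡ j q) (λ j → ⊕-inverseʳ j q)))

-- Cyclic words

data Kind : Set where
  full empty half : Kind

_≟ᴷ_ : DecidableEquality Kind
full  ≟ᴷ full  = yes refl
full  ≟ᴷ empty = no λ ()
full  ≟ᴷ half  = no λ ()
empty ≟ᴷ full  = no λ ()
empty ≟ᴷ empty = yes refl
empty ≟ᴷ half  = no λ ()
half  ≟ᴷ full  = no λ ()
half  ≟ᴷ empty = no λ ()
half  ≟ᴷ half  = yes refl

isFull isEmpty isHalf : Kind → Bool
isFull  k = does (k ≟ᴷ full)
isEmpty k = does (k ≟ᴷ empty)
isHalf  k = does (k ≟ᴷ half)

swap : Kind → Kind
swap full  = empty
swap empty = full
swap half  = half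

swap-involutive : ∀ k → swap (swap k) ≡ k
swap-involutive full  = refl
swap-involutive empty = refl
swap-involutive half  = refl

-- The rule for primed strings: x forces β just after it, y forces α, and a z is followed by the
-- opposite of its own letter.
step : Kind → Bool → Bool
step full  _ = true
step empty _ = false
step half  s = not s

isβ isα : Kind → Bool → Bool
isβ k s = if isHalf k then s else false
isα k s = if isHalf k then not s else false

Word : ℕ → Set
Word n = Fin (suc n) → Kind

-- s j says which of α and β a z at position j becomes: β if s j is true.
State : Word n → (Fin (suc n) → Bool) → Set
State w s = ∀ j → s (next j) ≡ step (w j) (s j)

β# α# : Word n → (Fin (suc n) → Bool) → ℕ
β# w s = # λ j → isβ (w j) (s j)
α# w s = # λ j → isα (w j) (s j)

#full #empty #half : Word n → ℕ
#full  w = # (isFull ∘ w)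
#empty w = # (isEmpty ∘ w)
#half  w = # (isHalf ∘ w)

Good : Word n → Set
Good w = ∃ λ s → State w s × Odd (β# w s)

-- Such a letter makes the state exist and be unique. With halves only, the state would flip at
-- every step, which is impossible round a cycle of odd length.
NonHalf : Word n → Set
NonHalf w = ∃ λ p → w p ≢ half

step-nonhalf : ∀ {k} → k ≢ half → ∀ s s′ → step k s ≡ step k s′
step-nonhalf {full}  _ _ _ = refl
step-nonhalf {empty} _ _ _ = refl
step-nonhalf {half}  k≢half = contradiction refl k≢half

isβ-nonhalf : ∀ {k} → k ≢ half → ∀ s s′ → isβ k s ≡ isβ k s′
isβ-nonhalf {full}  _ _ _ = refl
isβ-nonhalf {empty} _ _ _ = refl
isβ-nonhalf {half}  k≢half = contradiction refl k≢half

step-swap : ∀ k s → step (swap k) (not s) ≡ not (step k s)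
step-swap full  s = refl
step-swap empty s = refl
step-swap half  s = refl

isβ-swap : ∀ k s → isβ (swap k) (not s) ≡ isα k s
isβ-swap full  s = refl
isβ-swap empty s = refl
isβ-swap half  s = refl

α#+β# : ∀ (w : Word n) s → α# w s + β# w s ≡ #half w
α#+β# w s = trans
  (sym (∑-distrib-+ (λ j → bit (isα (w j) (s j))) (λ j → bit (isβ (w j) (s j)))))
  (sum-cong-≗ λ j → split (w j) (s j))
  where
  split : ∀ k s → bit (isα k s) + bit (isβ k s) ≡ bit (isHalf k)
  split full  _     = refl
  split empty _     = refl
  split half  true  = refl
  split half  false = refl

-- The letter at `p` fixes the state just after it whatever came before, and from there the state is
-- forced all the way round.
state-unique : ∀ (w : Word n) {s s′} → NonHalf w → State w s → State w s′ → s ≗ s′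
state-unique w {s} {s′} (p , wp≢half) st st′ = cyclic-induction (λ j → s j ≡ s′ j)
  (λ j e → trans (st j) (trans (cong (step (w j)) e) (sym (st′ j))))
  (next p) (trans (st p) (trans (step-nonhalf wp≢half _ _) (sym (st′ p))))

module StateExistence (w : Word n) where

  -- A letter other than half occurs among the k positions before j.
  Near : ℕ → Fin (suc n) → Set
  Near zero    j = ⊥
  Near (suc k) j = w (prev j) ≢ half ⊎ Near k (prev j)

  near : NonHalf w → ∀ j → ∃ λ k → Near k j
  near (p , wp≢half) = cyclic-induction (λ j → ∃ λ k → Near k j)
    (λ j (k , near-j) → suc k , inj₂ (subst (Near k) (sym (prev-next j)) near-j))
    (next p) (1 , inj₁ (subst (λ i → w i ≢ half) (sym (prev-next p)) wp≢half))

  look : ℕ → Fin (suc n) → Bool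
  -- An arbitrary starting value: it is forgotten as soon as the backward look meets a letter other
  -- than half.
  look zero    j = true
  look (suc k) j = step (w (prev j)) (look k (prev j))

  look-unique : ∀ k l j → Near k j → Near l j → look k j ≡ look l j
  look-unique (suc k) (suc l) j (inj₁ ≢half) _            = step-nonhalf ≢half _ _
  look-unique (suc k) (suc l) j (inj₂ _)     (inj₁ ≢half) = step-nonhalf ≢half _ _
  look-unique (suc k) (suc l) j (inj₂ a)     (inj₂ b)     =
    cong (step (w (prev j))) (look-unique k l (prev j) a b)

  state-exists : NonHalf w → ∃ (State w)
  state-exists nonhalf = s , λ j → let k , near-j = near nonhalf j in
    -- The depth chosen at `next j` is traded for one more than the depth chosen at `j`; then `look`
    -- unfolds to a single `step`.
    trans (look-unique _ (suc k) (next j) (proj₂ (near nonhalf (next j)))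
            (inj₂ (subst (Near k) (sym (prev-next j)) near-j)))
          (cong (λ i → step (w i) (look k i)) (prev-next j))
    where
    s : Fin (suc n) → Bool
    s j = look (proj₁ (near nonhalf j)) j

open StateExistence using (state-exists)

-- Complementation and rotation of words

swap-≢half : ∀ {k} → k ≢ half → swap k ≢ half
swap-≢half {half} ≢ _ = ≢ refl

swap-good : ∀ (w : Word n) {s} → State w s → Odd (α# w s) → Good (swap ∘ w)
swap-good w {s} st odd = not ∘ s ,
  (λ j → trans (cong not (st j)) (sym (step-swap (w j) (s j)))) ,
  subst Odd (sym (sum-cong-≗ λ j → cong bit (isβ-swap (w j) (s j)))) odd

-- The α's and β's add up to the odd number of halves, so one of the two counts is odd;
-- complementation turns α's into β's.
good-or-swap-good : ∀ (w : Word n) → NonHalf w → Odd (#half w) → Good w ⊎ Good (swap ∘ w)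
good-or-swap-good w nonhalf odd with s , st ← state-exists w nonhalf with 2 ∣? β# w s
... | no  β-odd  = inj₁ (s , st , β-odd)
... | yes β-even = inj₂ (swap-good w st λ α-even →
  odd (subst (2 ∣_) (α#+β# w s) (∣m∣n⇒∣m+n α-even β-even)))

-- By uniqueness the β's of `s` are those of the good state, an odd number. Were the α's odd too,
-- the number of halves would be even.
α-even : ∀ (w : Word n) → NonHalf w → Odd (#half w) → Good w → ∀ {s} → State w s → ¬ Odd (α# w s)
α-even w nonhalf odd (s′ , st′ , β-odd) {s} st α-odd = odd (subst (2 ∣_) (α#+β# w s)
  (odd+odd α-odd (subst Odd
    (sum-cong-≗ λ j → cong (bit ∘ isβ (w j)) (state-unique w nonhalf st′ st j)) β-odd)))

-- A state of the swapped word becomes, after negation, a state of `w` whose α's are the former β's.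
not-both-good : ∀ (w : Word n) → NonHalf w → Odd (#half w) → Good w → ¬ Good (swap ∘ w)
not-both-good w nonhalf odd good (s , st , β-odd) = α-even w nonhalf odd good {not ∘ s}
  (λ j → trans (cong not (st j)) (sym (trans
    (cong (λ k → step k (not (s j))) (sym (swap-involutive (w j))))
    (step-swap (swap (w j)) (s j)))))
  (subst Odd (sum-cong-≗ λ j → cong bit (flip (w j) (s j))) β-odd)
  where
  flip : ∀ k s → isβ (swap k) s ≡ isα k (not s)
  flip full  s = refl
  flip empty s = refl
  flip half  true  = refl
  flip half  false = refl

good-cong : ∀ {w w′ : Word n} → w ≗ w′ → Good w → Good w′
good-cong e (s , st , odd) = s , (λ j → trans (st j) (cong (λ k → step k (s j)) (e j))) ,
  subst Odd (sum-cong-≗ λ j → cong (λ k → bit (isβ k (s j))) (e j)) odd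

good-rotate : ∀ (w : Word n) q → Good w → Good (λ j → w (j ⊕ q))
good-rotate w q (s , st , odd) = (λ j → s (j ⊕ q)) ,
  (λ j → trans (cong s (⊕-comm j 1 q)) (st (j ⊕ q))) ,
  subst Odd (sym (#-rotate (λ j → isβ (w j) (s j)) q)) odd

-- The word xyxy…xyz of the pair (C , C + 1), up to rotation.
record Alternating (w : Word n) : Set where
  field
    full-empty : ∀ j → w j ≡ full → w (next j) ≡ empty
    empty-full : ∀ j → w (next j) ≡ empty → w j ≡ full
    half-full  : ∀ j → w j ≡ half → w (next j) ≡ full
    some-half  : ∃ λ p → w p ≡ half

  empty-half : ∀ j → w (next j) ≡ half → w j ≡ empty
  empty-half j e with w j in eq
  ... | full  with () ← trans (sym e) (full-empty j eq)
  ... | empty = refl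
  ... | half  with () ← trans (sym e) (half-full j eq)

-- Every half follows an empty letter and is therefore read as α, so there is no β at all.
alternating-not-good : ∀ {w : Word n} → Alternating w → ¬ Good w
alternating-not-good {w = w} alt (s , st , odd) = odd (subst (2 ∣_) (sym β#≡0) (2 ∣0))
  where
  open Alternating alt
  none : ∀ j → isβ (w (next j)) (s (next j)) ≡ false
  none j with w (next j) in eq
  ... | full  = refl
  ... | empty = refl
  ... | half  rewrite trans (st j) (cong (λ k → step k (s j)) (empty-half j eq)) = refl
  β#≡0 : β# w s ≡ 0
  β#≡0 = trans (sym (#-rotate (λ j → isβ (w j) (s j)) 1)) (#-zero none)

-- Changing one letter of a word

Move : Word n → Fin (suc n) → Kind → Word n → Set
Move w p k w′ = w′ p ≡ k × (∀ j → j ≢ p → w′ j ≡ w j)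

-- Only the state after p changes, and it is harmless if that state is not used
-- or not changed.
move-state : 1 ≤ n → ∀ {w w′ : Word n} {s p k} → State w s → Move w p k w′ →
  w (next p) ≢ half ⊎ step k (s p) ≡ step (w p) (s p) →
  ∃ λ s′ → State w′ s′ × β# w′ s′ + bit (isβ (w p) (s p)) ≡ β# w s + bit (isβ k (s p))
move-state {n} 1≤n {w} {w′} {s} {p} {k} st (w′p , w′j) harmless =
  s′ , st′ , trans (sum-change _ _ p (λ j j≢p → cong bit (β-agree j j≢p)))
    (cong (λ b → β# w s + bit b) (cong₂ isβ w′p s′p))
  where
  s′ : Fin (suc n) → Bool
  s′ = updateAt s (next p) (const (step k (s p)))
  s′-next : s′ (next p) ≡ step k (s p)
  s′-next = updateAt-updates (next p) s
  s′-other : ∀ j → j ≢ next p → s′ j ≡ s j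
  s′-other j = updateAt-minimal j (next p) s
  s′p : s′ p ≡ s p
  s′p = s′-other p (λ e → next-≢-self 1≤n p (sym e))
  -- Stated for any `f` that ignores the state at letters other than half, because it is needed both
  -- for `step` and for `isβ`.
  irrelevant : {A : Set} (f : Kind → Bool → A) → (∀ {k} → k ≢ half → ∀ s s′ → f k s ≡ f k s′) →
               f (w (next p)) (s′ (next p)) ≡ f (w (next p)) (s (next p))
  irrelevant f f-nonhalf = [ (λ ≢half → f-nonhalf ≢half _ _) ,
    (λ same → cong (f _) (trans s′-next (trans same (sym (st p))))) ]′ harmless
  agree : {A : Set} (f : Kind → Bool → A) → (∀ {k} → k ≢ half → ∀ s s′ → f k s ≡ f k s′) →
          ∀ j → j ≢ p → f (w′ j) (s′ j) ≡ f (w j) (s j)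
  agree f f-nonhalf j j≢p with j ≟ᶠ next p
  ... | yes refl = trans (cong (λ k → f k (s′ j)) (w′j j j≢p)) (irrelevant f f-nonhalf)
  ... | no  j≢   = cong₂ f (w′j j j≢p) (s′-other j j≢)
  β-agree : ∀ j → j ≢ p → isβ (w′ j) (s′ j) ≡ isβ (w j) (s j)
  β-agree = agree isβ isβ-nonhalf
  st′ : State w′ s′
  st′ j with j ≟ᶠ p
  ... | yes refl = trans s′-next (sym (cong₂ step w′p s′p))
  ... | no  j≢p  = trans (s′-other (next j) (next-≢ j≢p)) (trans (st j) (sym (agree step step-nonhalf j j≢p)))

-- The alternatives are the two effects of removing one element. When a full letter becomes half,
-- either element of the pair may go, so an exceptional result does no harm. When a half becomes
-- empty the removed element is forced, so the result must avoid the exceptional words; goodness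
-- excludes only one of their two forms, hence the extra clause.
move-good : 1 ≤ n → ∀ {w : Word n} →
  NonHalf w → #full w ≡ suc (#empty w) → (∃ λ p → w p ≡ empty) →
  (∃ λ p → w p ≡ full × ∀ w′ → Move w p half w′ → Good w′) ⊎
  (∃ λ p → w p ≡ half × ∀ w′ → Move w p empty w′ → Good w′ × ¬ Alternating (swap ∘ w′))
move-good {n} 1≤n {w} nonhalf excess (y , wy)
  with s , st ← state-exists w nonhalf with 2 ∣? β# w s
... | yes even = cases₁
  where
  -- Turning such a letter into a half adds one β, and the changed state after it is not read by the
  -- next letter.
  Late : Fin (suc n) → Set
  Late p = w p ≡ full × s p ≡ true × w (next p) ≢ half
  late? : ∀ p → Dec (Late p)
  late? p = (w p ≟ᴷ full) ×-dec (s p ≟ᵇ true) ×-dec ¬? (w (next p) ≟ᴷ half)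
  β? : ∀ p → Dec (w p ≡ half × s p ≡ true)
  β? p = (w p ≟ᴷ half) ×-dec (s p ≟ᵇ true)

  -- An empty letter leaves the same state behind as a β, namely `false`, so exactly one β
  -- disappears.
  β-move : ∀ p w′ → w p ≡ half → s p ≡ true → Move w p empty w′ → Good w′
  β-move p w′ wp sp move with s′ , st′ , e ← move-state 1≤n st move
      (inj₂ (sym (cong₂ step wp sp))) =
    s′ , st′ , λ 2∣β → even⇒odd-suc 2∣β (subst (2 ∣_)
      (trans (trans (sym (ℕ.+-identityʳ _)) (sym e′)) (ℕ.+-comm _ 1)) even)
    where
    e′ : β# w′ s′ + 1 ≡ β# w s + 0
    e′ = subst (λ b → β# w′ s′ + bit b ≡ β# w s + 0) (cong₂ isβ wp sp) e

  impossible : (∀ p → ¬ Late p) → (∀ p → ¬ (w p ≡ half × s p ≡ true)) → ⊥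
  impossible not-late no-β = ℕ.<-irrefl refl (begin-strict
    #full w                                ≡⟨ #-rotate (isFull ∘ w) 1 ⟨
    # (λ j → isFull (w (next j)))          ≤⟨ sum-mono _ _ full-after-empty ⟩
    #empty w                               <⟨ ℕ.n<1+n _ ⟩
    suc (#empty w)                         ≡⟨ excess ⟨
    #full w                                ∎)
    where
    open ℕ.≤-Reasoning
    -- A full letter with state `true` that is not late is followed by a half, which is then a β.
    s-false : ∀ j → w (next j) ≡ full → s (next j) ≢ true
    s-false j wj sj = not-late (next j) (wj , sj , λ w-half →
      no-β (next (next j)) (w-half , trans (st (next j)) (cong (λ k → step k (s (next j))) wj)))
    full-after-empty : ∀ j → bit (isFull (w (next j))) ≤ bit (isEmpty (w j))
    full-after-empty j with w (next j) in e
    ... | empty = z≤n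
    ... | half  = z≤n
    ... | full with w j in e′ | s j in e″
    ...   | empty | _ = ℕ.≤-refl
    ...   | full  | _ = contradiction (trans (st j) (cong (λ k → step k (s j)) e′)) (s-false j e)
    ...   | half  | true  = contradiction (e′ , e″) (no-β j)
    ...   | half  | false = contradiction (trans (st j) (cong₂ step e′ e″)) (s-false j e)

  cases₁ : _
  cases₁ with any? late?
  ... | yes (p , wp , sp , next≢half) = inj₁ (p , wp , λ w′ move →
    let s′ , st′ , e = move-state 1≤n {k = half} st move (inj₁ next≢half)
    in s′ , st′ , subst Odd (sym (trans (sym (ℕ.+-identityʳ _)) (trans
         (subst (λ b → β# w′ s′ + bit b ≡ β# w s + bit (s p)) (cong₂ isβ wp sp) e)
         (trans (cong (λ b → β# w s + bit b) sp) (ℕ.+-comm _ 1))))) (even⇒odd-suc even))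
  ... | no not-late with any? (λ p → β? p ×-dec (w (next p) ≟ᴷ empty))
  -- The move creates two adjacent empty letters, which a swapped alternating word does not contain.
  ... | yes (p , (wp , sp) , w-next) = inj₂ (p , wp , λ w′ move@(w′p , w′j) →
    β-move p w′ wp sp move , λ alt →
      case trans (sym (Alternating.full-empty alt p (cong swap w′p)))
        (cong swap (trans (w′j (next p) (next-≢-self 1≤n p)) w-next)) of λ ())
  ... | no no-β-empty with any? β?
  ... | yes (p , wp , sp) = inj₂ (p , wp , λ w′ move → β-move p w′ wp sp move , not-alternating w′ move)
    where
    -- Otherwise the half z of w′ is also read as β in w, and it is followed by
    -- an empty letter of w.
    not-alternating : ∀ w′ → Move w p empty w′ → ¬ Alternating (swap ∘ w′)
    not-alternating w′ (w′p , w′j) alt = no-β-empty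
      (z , (wz , sz) , trans (sym (w′j (next z) next-z≢p)) (unswap (half-full z swz)))
      where
      open Alternating alt
      unswap : ∀ {j k} → swap (w′ j) ≡ k → w′ j ≡ swap k
      unswap e = trans (sym (swap-involutive _)) (cong swap e)
      z = proj₁ some-half
      swz = proj₂ some-half
      w′z : w′ z ≡ half
      w′z = unswap swz
      z≢p : z ≢ p
      z≢p refl with () ← trans (sym w′z) w′p
      wz : w z ≡ half
      wz = trans (sym (w′j z z≢p)) w′z
      before : w′ (prev z) ≡ full
      before = unswap (empty-half (prev z) (trans (cong (swap ∘ w′) (next-prev z)) swz))
      prev≢p : prev z ≢ p
      prev≢p e with () ← trans (sym before) (trans (cong w′ e) w′p)
      sz : s z ≡ true
      sz = trans (cong s (sym (next-prev z))) (trans (st (prev z))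
        (cong (λ k → step k (s (prev z))) (trans (sym (w′j (prev z) prev≢p)) before)))
      -- The state after the β at `z` is `false`, while the state at `p` is `true`.
      next-z≢p : next z ≢ p
      next-z≢p e with () ← trans (sym (trans (cong s (sym e)) (trans (st z) (cong₂ step wz sz)))) sp
  ... | no no-β = contradiction (λ p h → no-β (p , h)) (impossible λ p h → not-late (p , h))
... | no odd = cases₂
  where
  cases₂ : _
  cases₂ with any? (λ p → (w p ≟ᴷ full) ×-dec (s p ≟ᵇ false))
  -- The new half is an α and leaves the state `true` behind it, as the full letter did, so the β's
  -- are the same.
  ... | yes (p , wp , sp) = inj₁ (p , wp , λ w′ move →
    let s′ , st′ , e = move-state 1≤n {k = half} st move
          (inj₂ (trans (cong not sp) (sym (cong (λ k → step k (s p)) wp))))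
    in s′ , st′ , subst Odd (sym (trans (sym (ℕ.+-identityʳ _)) (trans
         (subst (λ k → β# w′ s′ + bit (isβ k (s p)) ≡ β# w s + bit (s p)) wp e)
         (trans (cong (λ b → β# w s + bit b) sp) (ℕ.+-identityʳ _))))) odd)
  ... | no no-full with any? (λ p → (w p ≟ᴷ half) ×-dec (s p ≟ᵇ false) ×-dec ¬? (w (next p) ≟ᴷ half))
  -- Only an α disappears, and the next letter does not read the changed state.
  ... | yes (p , wp , sp , next≢half) = inj₂ (p , wp , λ w′ move →
    (let s′ , st′ , e = move-state 1≤n {k = empty} st move (inj₁ next≢half)
     in s′ , st′ , subst Odd (sym (ℕ.+-cancelʳ-≡ 0 _ _
         (subst (λ b → β# w′ s′ + bit b ≡ β# w s + 0) (cong₂ isβ wp sp) e))) odd) ,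
    not-alternating p w′ wp move)
    where
    -- Otherwise the empty letter at `y` would be followed by a full letter of `w`, whose state is
    -- `false`; `no-full` excludes this.
    not-alternating : ∀ p w′ → w p ≡ half → Move w p empty w′ → ¬ Alternating (swap ∘ w′)
    not-alternating p w′ wp (w′p , w′j) alt = no-full (next y ,
      trans (sym (w′j (next y) next-y≢p)) w′-next , trans (st y) (cong (λ k → step k (s y)) wy))
      where
      open Alternating alt
      y≢p : y ≢ p
      y≢p refl with () ← trans (sym wy) wp
      w′-next : w′ (next y) ≡ full
      w′-next = trans (sym (swap-involutive _))
        (cong swap (full-empty y (cong swap (trans (w′j y y≢p) wy))))
      next-y≢p : next y ≢ p
      next-y≢p e with () ← trans (sym w′-next) (trans (cong w′ e) w′p)
  ... | no no-half =
    contradiction (trans (sym excess) (#-zero λ j → dec-false (w j ≟ᴷ full) (no-full-letter j))) λ ()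
    where
    -- An empty letter or a β before a full one would give it the state `false`, against `no-full`;
    -- an α there is excluded by `no-half`. Going round from the empty letter at `y`, no full letter
    -- can then ever start.
    after-full : ∀ j → w (next j) ≡ full → w j ≡ full
    after-full j w-next with w j in e
    ... | full  = refl
    ... | empty = contradiction (next j , w-next , trans (st j) (cong (λ k → step k (s j)) e)) no-full
    ... | half  with s j in e′
    ...   | true  = contradiction (next j , w-next , trans (st j) (cong₂ step e e′)) no-full
    ...   | false = contradiction (j , e , e′ , λ h → case trans (sym w-next) h of λ ()) no-half
    no-full-letter : ∀ j → w j ≢ full
    no-full-letter = cyclic-induction (λ j → w j ≢ full) (λ j ≢full e → ≢full (after-full j e)) y
      λ e → case trans (sym wy) e of λ ()

-- Counting letters

#-zero⁻¹ : (f : Fin n → Bool) → # f ≡ 0 → ∀ j → f j ≡ false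
#-zero⁻¹ f e zero with f zero
... | false = refl
#-zero⁻¹ f e (suc j) = #-zero⁻¹ (f ∘ suc) (ℕ.m+n≡0⇒n≡0 (bit (f zero)) e) j

∣tabulate∣ : (f : Fin n → Bool) → ∣ tabulate f ∣ ≡ # f
∣tabulate∣ {zero}  f = refl
∣tabulate∣ {suc n} f = trans (∣∷∣ (f zero) (tabulate (f ∘ suc)))
  (cong (bit (f zero) +_) (∣tabulate∣ (f ∘ suc)))

count≡# : ∀ {A : Set} {P : Pred A 0ℓ} (P? : ∀ x → Dec (P x)) (v : Vec A n) →
          count P? v ≡ # λ j → does (P? (lookup v j))
count≡# P? []      = refl
count≡# P? (x ∷ v) with does (P? x)
... | true  = cong suc (count≡# P? v)
... | false = count≡# P? v

#-complement : (f : Fin n → Bool) → # f + # (not ∘ f) ≡ n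
#-complement {zero}  f = refl
#-complement {suc n} f with f zero
... | true  = cong suc (#-complement (f ∘ suc))
... | false = trans (ℕ.+-suc _ _) (cong suc (#-complement (f ∘ suc)))

#-kinds : (w : Fin n → Kind) → # (isFull ∘ w) + # (isEmpty ∘ w) + # (isHalf ∘ w) ≡ n
#-kinds {zero}  w = refl
#-kinds {suc n} w with w zero
... | full  = cong suc (#-kinds (w ∘ suc))
... | empty = trans (cong (_+ # (isHalf ∘ w ∘ suc)) (ℕ.+-suc (# (isFull ∘ w ∘ suc)) _))
                    (cong suc (#-kinds (w ∘ suc)))
... | half  = trans (ℕ.+-suc _ _) (cong suc (#-kinds (w ∘ suc)))

-- Full and empty letters together contribute an even number to the odd length.
half-odd : (w : Word n) → Odd (suc n) → #full w ≡ #empty w → Odd (#half w)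
half-odd {n} w odd balanced half-even = odd (subst (2 ∣_)
  (trans (cong (λ t → t + #half w) (solve 1 (λ a → con 2 :* a := a :+ a) refl (#full w)))
    (trans (cong (λ t → #full w + t + #half w) balanced) (#-kinds w)))
  (∣m∣n⇒∣m+n (m∣m*n (#full w)) half-even))
  where open +-*-Solver

-- Words up to rotation

⊕-% : ∀ (i : Fin (suc n)) a → i ⊕ (a % suc n) ≡ i ⊕ a
⊕-% {n} i a = toℕ-injective (begin
  toℕ (i ⊕ (a % m))               ≡⟨ toℕ-⊕ i (a % m) ⟩
  (toℕ i + a % m) % m             ≡⟨ %-distribˡ-+ (toℕ i) (a % m) m ⟩
  (toℕ i % m + a % m % m) % m     ≡⟨ cong (λ t → (toℕ i % m + t) % m) (m%n%n≡m%n a m) ⟩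
  (toℕ i % m + a % m) % m         ≡⟨ %-distribˡ-+ (toℕ i) a m ⟨
  (toℕ i + a) % m                 ≡⟨ toℕ-⊕ i a ⟨
  toℕ (i ⊕ a)                     ∎)
  where
  open ≡-Reasoning
  m = suc n

-- Orbits are indexed by labels from 1 to `suc n`. The label of `(q + n) mod suc n` is congruent to
-- `q + suc n`, hence to `q`.
⊕-label : ∀ (i : Fin (suc n)) q → i ⊕ label ((q + n) mod suc n) ≡ i ⊕ q
⊕-label {n} i q = begin
  i ⊕ label ((q + n) mod suc n)         ≡⟨ cong (λ t → i ⊕ suc t) (toℕ-fromℕ< (m%n<n (q + n) (suc n))) ⟩
  i ⊕ suc ((q + n) % suc n)             ≡⟨ ⊕-⊕ i 1 _ ⟨
  (i ⊕ 1) ⊕ ((q + n) % suc n)           ≡⟨ ⊕-% (i ⊕ 1) (q + n) ⟩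
  (i ⊕ 1) ⊕ (q + n)                     ≡⟨ ⊕-⊕ (i ⊕ 1) q n ⟨
  ((i ⊕ 1) ⊕ q) ⊕ n                     ≡⟨ cong (_⊕ n) (⊕-comm i 1 q) ⟩
  ((i ⊕ q) ⊕ 1) ⊕ n                     ≡⟨ prev-next (i ⊕ q) ⟩
  i ⊕ q                                 ∎
  where open ≡-Reasoning

Turn : ℕ → Word n → Word n → Set
Turn q w v = ∀ j → w (j ⊕ q) ≡ v j

unturn : ∀ {q} {w v : Word n} → Turn q w v → Turn (q * n) v w
unturn {q = q} {w} turn j = trans (sym (turn _)) (cong w (⊕-inverseˡ j q))

good-turn : ∀ {q} {w v : Word n} → Turn q w v → Good w → Good v
good-turn {q = q} {w} turn = good-cong turn ∘ good-rotate w q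

alternating-turn : ∀ {q} {w v : Word n} → Turn q w v → Alternating w → Alternating v
alternating-turn {q = q} {w} {v} turn alt = record
  { full-empty = λ j e → at-next j (full-empty (j ⊕ q) (trans (turn j) e))
  ; empty-full = λ j e → trans (sym (turn j)) (empty-full (j ⊕ q) (trans (sym (next-at j)) e))
  ; half-full  = λ j e → at-next j (half-full (j ⊕ q) (trans (turn j) e))
  ; some-half  = let p , e = some-half in
      p ⊕ (q * _) , trans (sym (turn _)) (trans (cong w (⊕-inverseˡ p q)) e)
  }
  where
  open Alternating alt
  next-at : ∀ j → v (next j) ≡ w (next (j ⊕ q))
  next-at j = trans (sym (turn (next j))) (cong w (⊕-comm j 1 q))
  at-next : ∀ j {k} → w (next (j ⊕ q)) ≡ k → v (next j) ≡ k
  at-next j = trans (next-at j)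

-- Signatures

pairKind : Bool → Bool → Kind
pairKind a b = if a then full else if b then empty else half

pairWord : Subset (suc n) → Subset (suc n) → Word n
pairWord X Y j = pairKind (lookup X j) (lookup Y j)

pairWord-∈ˡ : ∀ (X Y : Subset (suc n)) {j} → j ∈ X → pairWord X Y j ≡ full
pairWord-∈ˡ X Y {j} j∈X = cong (λ a → pairKind a (lookup Y j)) ([]=⇒lookup j∈X)

pairWord-∈ʳ : ∀ (X Y : Subset (suc n)) {j} → Disjoint X Y → j ∈ Y → pairWord X Y j ≡ empty
pairWord-∈ʳ X Y disjoint j∈Y =
  cong₂ pairKind (∉-lookup X λ j∈X → disjoint (_ , x∈p∩q⁺ (j∈X , j∈Y))) ([]=⇒lookup j∈Y)

pairWord-∉ : ∀ (X Y : Subset (suc n)) {j} → j ∉ X → j ∉ Y → pairWord X Y j ≡ half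
pairWord-∉ X Y j∉X j∉Y = cong₂ pairKind (∉-lookup X j∉X) (∉-lookup Y j∉Y)

letter : Kind → Letter
letter full  = 𝕩
letter empty = 𝕪
letter half  = 𝕫

primed : Kind → Bool → Letter
primed full  _     = 𝕩
primed empty _     = 𝕪
primed half  true  = β
primed half  false = α

-- The state after a letter of the primed string; junk at 𝕫, which does not
-- occur there.
after : Letter → Bool
after 𝕩 = true
after 𝕪 = false
after 𝕫 = true
after α = true
after β = false

after-primed : ∀ k s → after (primed k s) ≡ step k s
after-primed full  _     = refl
after-primed empty _     = refl
after-primed half  true  = refl
after-primed half  false = refl

module _ (X Y : Subset (suc n)) where

  private
    v = pairWord X Y

  lookup-string : ∀ j → lookup (string X Y) j ≡ letter (v j)
  lookup-string j = trans
    (lookup∘tabulate (λ i → if lookup X i then 𝕩 else if lookup Y i then 𝕪 else 𝕫) j)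
    (eq (lookup X j) (lookup Y j))
    where
    eq : ∀ a b → (if a then 𝕩 else if b then 𝕪 else 𝕫) ≡
                 letter (pairKind a b)
    eq true  _     = refl
    eq false true  = refl
    eq false false = refl

  state⇒primed : ∀ {s} → State v s → Primed (string X Y) (tabulate λ j → primed (v j) (s j))
  state⇒primed {s} st i
    rewrite lookup-string i | lookup-string (prev i)
          | lookup∘tabulate (λ j → primed (v j) (s j)) i
          | lookup∘tabulate (λ j → primed (v j) (s j)) (prev i)
    = check (v i) (v (prev i)) (s i) (s (prev i))
        (trans (cong s (sym (next-prev i))) (st (prev i)))
    where
    -- The conditions involve only two neighbouring letters and their states, so finitely many cases
    -- remain.
    check : ∀ k k′ b b′ → b ≡ step k′ b′ →
      (letter k ≡ 𝕩 ⊎ letter k ≡ 𝕪 → primed k b ≡ letter k) ×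
      (letter k ≡ 𝕫 → (primed k b ≡ α ⊎ primed k b ≡ β) × primed k b ≢ primed k′ b′ ×
        (letter k′ ≡ 𝕩 → primed k b ≡ β) × (letter k′ ≡ 𝕪 → primed k b ≡ α))
    check full  _     _ _ _    = (λ _ → refl) , λ ()
    check empty _     _ _ _    = (λ _ → refl) , λ ()
    check half  full  _ _ refl = (λ { (inj₁ ()) ; (inj₂ ()) }) , λ _ → inj₂ refl , (λ ()) , (λ _ → refl) , λ ()
    check half  empty _ _ refl = (λ { (inj₁ ()) ; (inj₂ ()) }) , λ _ → inj₁ refl , (λ ()) , (λ ()) , λ _ → refl
    check half  half  _ true  refl = (λ { (inj₁ ()) ; (inj₂ ()) }) , λ _ → inj₁ refl , (λ ()) , (λ ()) , λ ()
    check half  half  _ false refl = (λ { (inj₁ ()) ; (inj₂ ()) }) , λ _ → inj₂ refl , (λ ()) , (λ ()) , λ ()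

  -- The state at a position is read off the primed letter just before it.
  primed⇒state : ∀ {d′} → Primed (string X Y) d′ →
    ∃ λ s → State v s × ∀ j → lookup d′ j ≡ primed (v j) (s j)
  primed⇒state {d′} pr = s , st , d′≡
    where
    s : Fin (suc n) → Bool
    s j = after (lookup d′ (prev j))
    check : ∀ k k′ (e e′ : Letter) →
      ((letter k ≡ 𝕩 ⊎ letter k ≡ 𝕪 → e ≡ letter k) ×
       (letter k ≡ 𝕫 → (e ≡ α ⊎ e ≡ β) × e ≢ e′ × (letter k′ ≡ 𝕩 → e ≡ β) × (letter k′ ≡ 𝕪 → e ≡ α))) →
      (letter k′ ≡ 𝕩 ⊎ letter k′ ≡ 𝕪 → e′ ≡ letter k′) × (letter k′ ≡ 𝕫 → e′ ≡ α ⊎ e′ ≡ β) →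
      e ≡ primed k (after e′)
    check full  _ _ _ (h , _) _ = h (inj₁ refl)
    check empty _ _ _ (h , _) _ = h (inj₂ refl)
    check half full  e e′ (_ , h) (h′ , _) rewrite h′ (inj₁ refl) = proj₁ (proj₂ (proj₂ (h refl))) refl
    check half empty e e′ (_ , h) (h′ , _) rewrite h′ (inj₂ refl) = proj₂ (proj₂ (proj₂ (h refl))) refl
    check half half  e e′ (_ , h) (_ , h′) with h refl | h′ refl
    ... | inj₁ refl , ≢ , _ | inj₁ refl = contradiction refl ≢
    ... | inj₁ refl , ≢ , _ | inj₂ refl = refl
    ... | inj₂ refl , ≢ , _ | inj₁ refl = refl
    ... | inj₂ refl , ≢ , _ | inj₂ refl = contradiction refl ≢
    d′≡ : ∀ j → lookup d′ j ≡ primed (v j) (s j)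
    d′≡ j with pr j | pr (prev j)
    ... | h | h′ rewrite lookup-string j | lookup-string (prev j) =
      check (v j) (v (prev j)) _ _ h (proj₁ h′ , proj₁ ∘ proj₂ h′)
    st : State v s
    st j = trans (cong (after ∘ lookup d′) (prev-next j))
      (trans (cong after (d′≡ j)) (after-primed (v j) (s j)))

  β-count : ∀ {d′ s} → (∀ j → lookup d′ j ≡ primed (v j) (s j)) → count (β ≟ᴸ_) d′ ≡ β# v s
  β-count {d′} {s} e = trans (count≡# (β ≟ᴸ_) d′)
    (sum-cong-≗ λ j → cong bit (trans (cong (does ∘ (β ≟ᴸ_)) (e j)) (is (v j) (s j))))
    where
    is : ∀ k b → does (β ≟ᴸ primed k b) ≡ isβ k b
    is full  _     = refl
    is empty _     = refl
    is half  true  = refl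
    is half  false = refl

  α-count : ∀ {d′ s} → (∀ j → lookup d′ j ≡ primed (v j) (s j)) → count (α ≟ᴸ_) d′ ≡ α# v s
  α-count {d′} {s} e = trans (count≡# (α ≟ᴸ_) d′)
    (sum-cong-≗ λ j → cong bit (trans (cong (does ∘ (α ≟ᴸ_)) (e j)) (is (v j) (s j))))
    where
    is : ∀ k b → does (α ≟ᴸ primed k b) ≡ isα k b
    is full  _     = refl
    is empty _     = refl
    is half  true  = refl
    is half  false = refl

  sgn-β⇒good : sgn X Y β → Good v
  sgn-β⇒good (_ , d′ , pr , odd) with s , st , e ← primed⇒state {d′} pr =
    s , st , subst Odd (β-count {d′} e) odd

  -- The good state yields a primed string with an odd number of β's. Any primed string comes from a
  -- state, and `α-even` keeps α out of the signature.
  good⇒sgn≐β : NonHalf v → Odd (#half v) → Good v → sgn X Y ≐ ｛ β ｝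
  good⇒sgn≐β nonhalf odd good@(s , st , β-odd) = ⊆ , λ { refl → inj₂ refl , d , state⇒primed st ,
      subst Odd (sym (β-count {d} (lookup∘tabulate (λ j → primed (v j) (s j))))) β-odd }
    where
    d = tabulate λ j → primed (v j) (s j)
    ⊆ : ∀ {e} → sgn X Y e → β ≡ e
    ⊆ (inj₂ refl , _) = refl
    ⊆ (inj₁ refl , d′ , pr , α-odd) with s′ , st′ , e ← primed⇒state {d′} pr =
      contradiction (subst Odd (α-count {d′} e) α-odd) (α-even v nonhalf odd good st′)

-- Removing elements from subsets

∣remove∣ : ∀ (S : Subset n) e → lookup S e ≡ true → suc ∣ S [ e ]≔ false ∣ ≡ ∣ S ∣
∣remove∣ (true  ∷ S) zero    refl = refl
∣remove∣ (true  ∷ S) (suc e) h    = cong suc (∣remove∣ S e h)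
∣remove∣ (false ∷ S) (suc e) h    = ∣remove∣ S e h

remove-⊆ : ∀ (S : Subset n) e → S [ e ]≔ false ⊆ S
remove-⊆ S e {i} i∈ with i ≟ᶠ e
... | yes refl with () ← trans (sym ([]=⇒lookup i∈)) (lookup∘update e S false)
... | no  i≢e  = lookup⇒[]= i S (trans (sym (lookup∘update′ i≢e S false)) ([]=⇒lookup i∈))

subset-of-size : ∀ k (S : Subset n) → k ≤ ∣ S ∣ → ∃ λ T → T ⊆ S × ∣ T ∣ ≡ k
subset-of-size {zero} zero [] k≤ = [] , (λ ()) , refl
subset-of-size k (false ∷ S) k≤ with T , T⊆S , e ← subset-of-size k S k≤ =
  false ∷ T , (λ { (Vec.there i∈) → Vec.there (T⊆S i∈) }) , e
subset-of-size zero (true ∷ S) k≤ with T , T⊆S , e ← subset-of-size zero S z≤n =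
  false ∷ T , (λ { (Vec.there i∈) → Vec.there (T⊆S i∈) }) , e
subset-of-size (suc k) (true ∷ S) (s≤s k≤) with T , T⊆S , e ← subset-of-size k S k≤ =
  true ∷ T , (λ { Vec.here → Vec.here ; (Vec.there i∈) → Vec.there (T⊆S i∈) }) , cong suc e

-- Subsets of `E m` as cyclic words

module Blocks (n : ℕ) (2≤n : 2 ≤ n) (m-odd : Odd (suc n)) where

  private
    m : ℕ
    m = suc n

  System : Set₁
  System = SetSystem (m + m)

  un pr : Subset (m + m) → Fin m → Bool
  un T j = lookup T (j ↑ˡ m)
  pr T j = lookup T (m ↑ʳ j)

  kind : Bool → Bool → Kind
  kind true  true  = full
  kind true  false = half
  kind false true  = half
  kind false false = empty

  word : Subset (m + m) → Word n
  word T j = kind (un T j) (pr T j)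

  E-cases : (P : E m → Set) → (∀ j → P (j ↑ˡ m)) → (∀ j → P (m ↑ʳ j)) → ∀ e → P e
  E-cases P l r e = subst P (join-splitAt m m e) (cases (splitAt m e))
    where
    cases : ∀ x → P (join m m x)
    cases (inj₁ j) = l j
    cases (inj₂ j) = r j

  ↑ˡ≢↑ʳ : ∀ (i j : Fin m) → i ↑ˡ m ≢ m ↑ʳ j
  ↑ˡ≢↑ʳ i j e with () ← trans (sym (splitAt-↑ˡ m i m)) (trans (cong (splitAt m) e) (splitAt-↑ʳ m m j))

  subset-ext : ∀ {S T : Subset (m + m)} → un S ≗ un T → pr S ≗ pr T → S ≡ T
  subset-ext {S} {T} un≗ pr≗ = trans (sym (tabulate∘lookup S))
    (trans (tabulate-cong (E-cases (λ e → lookup S e ≡ lookup T e) un≗ pr≗)) (tabulate∘lookup T))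

  -- T = ρ^q (S)
  Rotated : ℕ → Subset (m + m) → Subset (m + m) → Set
  Rotated q S T = (∀ j → un T (j ⊕ q) ≡ un S j) × (∀ j → pr T (j ⊕ q) ≡ pr S j)

  ρ^ : ℕ → E m → E m
  ρ^ q e = iterate (ρ m) e q

  ρ^-↑ˡ : ∀ q (j : Fin m) → ρ^ q (j ↑ˡ m) ≡ (j ⊕ q) ↑ˡ m
  ρ^-↑ˡ zero    j = cong (_↑ˡ m) (sym (⊕-multiple j 0))
  ρ^-↑ˡ (suc q) j rewrite splitAt-↑ˡ m j m =
    trans (ρ^-↑ˡ q (next j)) (cong (_↑ˡ m) (⊕-⊕ j 1 q))

  ρ^-↑ʳ : ∀ q (j : Fin m) → ρ^ q (m ↑ʳ j) ≡ m ↑ʳ (j ⊕ q)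
  ρ^-↑ʳ zero    j = cong (m ↑ʳ_) (sym (⊕-multiple j 0))
  ρ^-↑ʳ (suc q) j rewrite splitAt-↑ʳ m m j =
    trans (ρ^-↑ʳ q (next j)) (cong (m ↑ʳ_) (⊕-⊕ j 1 q))

  lookup-image : ∀ (f : E m → E m) → (∀ {d e} → f d ≡ f e → d ≡ e) →
                 ∀ S e → lookup (image f S) (f e) ≡ lookup S e
  lookup-image f inj S e with lookup S e in eq
  ... | true  = []=⇒lookup (∈-image⁺ f S (lookup⇒[]= e S eq))
  ... | false = ∉-lookup (image f S) λ fe∈ → case ∈-image⁻ f S fe∈ of λ
    (d , d∈S , fd≡fe) → lookup-∉ S eq (subst (_∈ S) (inj fd≡fe) d∈S)

  rotated-image : ∀ q S → Rotated q S (image (ρ^ q) S)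
  rotated-image q S =
    (λ j → trans (cong (lookup (image (ρ^ q) S)) (sym (ρ^-↑ˡ q j)))
      (lookup-image (ρ^ q) (ρ^-injective m q) S _)) ,
    (λ j → trans (cong (lookup (image (ρ^ q) S)) (sym (ρ^-↑ʳ q j)))
      (lookup-image (ρ^ q) (ρ^-injective m q) S _))

  rotated-unique : ∀ {q S T T′} → Rotated q S T → Rotated q S T′ → T ≡ T′
  rotated-unique {q} {S} {T} {T′} (u , p) (u′ , p′) = subset-ext
    (λ j → subst (λ i → un T i ≡ un T′ i) (⊕-inverseˡ j q)
      (trans (u (j ⊕ (q * n))) (sym (u′ (j ⊕ (q * n))))))
    (λ j → subst (λ i → pr T i ≡ pr T′ i) (⊕-inverseˡ j q)
      (trans (p (j ⊕ (q * n))) (sym (p′ (j ⊕ (q * n))))))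

  orbit⁺ : ∀ {𝒜 : System} {q S T} → 𝒜 S → Rotated q S T → orbit m 𝒜 T
  orbit⁺ {q = q} {S} {T} S∈𝒜 (u , p) = i , S , S∈𝒜 , rotated-unique {label i} {S}
    ((λ j → trans (cong (un T) (⊕-label j q)) (u j)) , (λ j → trans (cong (pr T) (⊕-label j q)) (p j)))
    (rotated-image (label i) S)
    where
    i : Fin m
    i = (q + n) mod m

  orbit⁻ : ∀ {𝒜 : System} {T} → orbit m 𝒜 T → ∃₂ λ q S → 𝒜 S × Rotated q S T
  orbit⁻ (i , S , S∈𝒜 , refl) = label i , S , S∈𝒜 , rotated-image (label i) S

  rotated-word : ∀ {q S T} → Rotated q S T → Turn q (word T) (word S)
  rotated-word (u , p) j = cong₂ kind (u j) (p j)

  unrotate : ∀ q T → ∃ λ S → Rotated q S T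
  unrotate q T with u , p ← rotated-image (q * n) T = image (ρ^ (q * n)) T ,
    (λ j → trans (sym (u (j ⊕ q))) (cong (un (image (ρ^ (q * n)) T)) (⊕-inverseʳ j q))) ,
    (λ j → trans (sym (p (j ⊕ q))) (cong (pr (image (ρ^ (q * n)) T)) (⊕-inverseʳ j q)))

  -- Words and the orbits `⟨ X ∥ Y ⟩`

  pair-size : ∀ j (T : Subset (m + m)) →
              ∣ (⁅ j ⁆ ∪′ ⁅ j ⁆) ∩ T ∣ ≡ bit (un T j) + bit (pr T j)
  pair-size j T with P , Q , refl ← Vec.splitAt m T = begin
    ∣ (⁅ j ⁆ ++ ⁅ j ⁆) ∩ (P ++ Q) ∣        ≡⟨ cong ∣_∣ (zipWith-++ _ ⁅ j ⁆ ⁅ j ⁆ P Q) ⟩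
    ∣ (⁅ j ⁆ ∩ P) ++ (⁅ j ⁆ ∩ Q) ∣         ≡⟨ ∣++∣ (⁅ j ⁆ ∩ P) (⁅ j ⁆ ∩ Q) ⟩
    ∣ ⁅ j ⁆ ∩ P ∣ + ∣ ⁅ j ⁆ ∩ Q ∣          ≡⟨ cong₂ _+_ (∣⁅⁆∩∣ j P) (∣⁅⁆∩∣ j Q) ⟩
    bit (lookup P j) + bit (lookup Q j)    ≡⟨ cong₂ (λ a b → bit a + bit b)
                                                 (lookup-++ˡ P Q j) (lookup-++ʳ P Q j) ⟨
    bit (un (P ++ Q) j) + bit (pr (P ++ Q) j) ∎
    where open ≡-Reasoning

  weight : Kind → ℕ
  weight full  = 2
  weight empty = 0
  weight half  = 1

  kind-weight : ∀ a b → bit a + bit b ≡ weight (kind a b)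
  kind-weight true  true  = refl
  kind-weight true  false = refl
  kind-weight false true  = refl
  kind-weight false false = refl

  weight-injective : ∀ {k l} → weight k ≡ weight l → k ≡ l
  weight-injective {full}  {full}  _ = refl
  weight-injective {empty} {empty} _ = refl
  weight-injective {half}  {half}  _ = refl

  pair-weight : ∀ j T → ∣ (⁅ j ⁆ ∪′ ⁅ j ⁆) ∩ T ∣ ≡ weight (word T j)
  pair-weight j T = trans (pair-size j T) (kind-weight (un T j) (pr T j))

  -- The numbers 2, 0 and 1 tell the three kinds apart, so the cardinality conditions fix every
  -- letter.
  [∥]⁻ : ∀ X Y {T} → [ X ∥ Y ] T → word T ≗ pairWord X Y
  [∥]⁻ X Y {T} h j with lookup X j in eX | lookup Y j in eY | h j
  ... | true  | _     | h₂ , _  , _  = weight-injective (trans (sym (pair-weight j T)) (h₂ (lookup⇒[]= j X eX)))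
  ... | false | true  | _  , h₀ , _  = weight-injective (trans (sym (pair-weight j T)) (h₀ (lookup⇒[]= j Y eY)))
  ... | false | false | _  , _  , h₁ =
    weight-injective (trans (sym (pair-weight j T)) (h₁ (lookup-∉ X eX , lookup-∉ Y eY)))

  [∥]⁺ : ∀ X Y {T} → Disjoint X Y → word T ≗ pairWord X Y → [ X ∥ Y ] T
  [∥]⁺ X Y {T} disjoint e j =
    (λ j∈X → trans (pair-weight j T) (cong weight (trans (e j) (pairWord-∈ˡ X Y j∈X)))) ,
    (λ j∈Y → trans (pair-weight j T) (cong weight (trans (e j) (pairWord-∈ʳ X Y disjoint j∈Y)))) ,
    (λ (j∉X , j∉Y) → trans (pair-weight j T) (cong weight (trans (e j) (pairWord-∉ X Y j∉X j∉Y))))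

  ⟨∥⟩⁻ : ∀ {X Y T} → ⟨ X ∥ Y ⟩ T → ∃ λ q → Turn q (word T) (pairWord X Y)
  ⟨∥⟩⁻ {X} {Y} {T} t with q , S , S∈ , rot ← orbit⁻ {[ X ∥ Y ]} {T} t =
    q , λ j → trans (rotated-word {S = S} {T} rot j) ([∥]⁻ X Y {S} S∈ j)

  ⟨∥⟩⁺ : ∀ {X Y T q} → Disjoint X Y → Turn q (word T) (pairWord X Y) → ⟨ X ∥ Y ⟩ T
  ⟨∥⟩⁺ {X} {Y} {T} {q} disjoint turn with S , rot ← unrotate q T = orbit⁺ {[ X ∥ Y ]} {S = S} {T}
    ([∥]⁺ X Y disjoint λ j → trans (sym (rotated-word {S = S} {T} rot j)) (turn j)) rot

  -- Orbits with a common member coincide. This is what allows conditions on orbits to be tested on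
  -- a single set.
  ⟨∥⟩-⊆ : ∀ {X Y X′ Y′ T} → Disjoint X′ Y′ → ⟨ X ∥ Y ⟩ T → ⟨ X′ ∥ Y′ ⟩ T →
          ∀ {U} → ⟨ X ∥ Y ⟩ U → ⟨ X′ ∥ Y′ ⟩ U
  ⟨∥⟩-⊆ {T = T} disjoint′ t t′ {U} u
    with q , turn ← ⟨∥⟩⁻ {T = T} t | q′ , turn′ ← ⟨∥⟩⁻ {T = T} t′ | r , turnᵤ ← ⟨∥⟩⁻ {T = U} u =
    -- The rotation passes from the second pair to `T` by `q′`, back to the first pair by the
    -- inverse of `q`, and on to `U` by `r`.
    ⟨∥⟩⁺ {T = U} {q = q′ + q * n + r} disjoint′ λ j → begin
      word U (j ⊕ (q′ + q * n + r))           ≡⟨ cong (word U) (⊕-⊕ j (q′ + q * n) r) ⟨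
      word U ((j ⊕ (q′ + q * n)) ⊕ r)         ≡⟨ turnᵤ (j ⊕ (q′ + q * n)) ⟩
      _                                       ≡⟨ turn (j ⊕ (q′ + q * n)) ⟨
      word T ((j ⊕ (q′ + q * n)) ⊕ q)         ≡⟨ cong (λ i → word T (i ⊕ q)) (⊕-⊕ j q′ (q * n)) ⟨
      word T (((j ⊕ q′) ⊕ (q * n)) ⊕ q)       ≡⟨ cong (word T) (⊕-inverseˡ (j ⊕ q′) q) ⟩
      word T (j ⊕ q′)                         ≡⟨ turn′ j ⟩
      _                                       ∎
    where open ≡-Reasoning

  ⟨∥⟩-≐ : ∀ {X Y X′ Y′ T} → Disjoint X Y → Disjoint X′ Y′ →
          ⟨ X ∥ Y ⟩ T → ⟨ X′ ∥ Y′ ⟩ T → ⟨ X ∥ Y ⟩ ≐ ⟨ X′ ∥ Y′ ⟩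
  ⟨∥⟩-≐ {T = T} d d′ t t′ = (λ {U} → ⟨∥⟩-⊆ {T = T} d′ t t′ {U}) , (λ {U} → ⟨∥⟩-⊆ {T = T} d t′ t {U})

  -- Size and complement in terms of words

  fulls empties : Word n → Subset m
  fulls   w = tabulate (isFull ∘ w)
  empties w = tabulate (isEmpty ∘ w)

  pairWord-fulls-empties : ∀ w → w ≗ pairWord (fulls w) (empties w)
  pairWord-fulls-empties w j
    rewrite lookup∘tabulate (isFull ∘ w) j | lookup∘tabulate (isEmpty ∘ w) j with w j
  ... | full  = refl
  ... | empty = refl
  ... | half  = refl

  fulls-empties-disjoint : ∀ w → Disjoint (fulls w) (empties w)
  fulls-empties-disjoint w (j , j∈)
    with a ← trans (sym (lookup∘tabulate (isFull ∘ w) j)) ([]=⇒lookup (proj₁ (x∈p∩q⁻ (fulls w) (empties w) j∈)))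
       | b ← trans (sym (lookup∘tabulate (isEmpty ∘ w) j)) ([]=⇒lookup (proj₂ (x∈p∩q⁻ (fulls w) (empties w) j∈)))
    with w j
  fulls-empties-disjoint w (j , j∈) | full with () ← b
  fulls-empties-disjoint w (j , j∈) | empty with () ← a
  fulls-empties-disjoint w (j , j∈) | half with () ← a

  -- A pair contributes one element, one more if it is full and one less if it is empty.
  size : ∀ T → ∣ T ∣ + #empty (word T) ≡ m + #full (word T)
  size T with P , Q , refl ← Vec.splitAt m T = begin
    ∣ P ++ Q ∣ + #empty w                  ≡⟨ cong₂ _+_ (∣++∣ P Q) (sym (∣tabulate∣ (isEmpty ∘ w))) ⟩
    ∣ P ∣ + ∣ Q ∣ + ∣ empties w ∣          ≡⟨ balanced-size (fulls w) (empties w) P Q balance ⟩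
    m + ∣ fulls w ∣                        ≡⟨ cong (m +_) (∣tabulate∣ (isFull ∘ w)) ⟩
    m + #full w                            ∎
    where
    open ≡-Reasoning
    w = word (P ++ Q)
    balance : ∀ j → bit (lookup P j) + bit (lookup Q j) + bit (lookup (empties w) j)
                    ≡ suc (bit (lookup (fulls w) j))
    balance j rewrite lookup∘tabulate (isFull ∘ w) j | lookup∘tabulate (isEmpty ∘ w) j
      | lookup-++ˡ P Q j | lookup-++ʳ P Q j with lookup P j | lookup Q j
    ... | true  | true  = refl
    ... | true  | false = refl
    ... | false | true  = refl
    ... | false | false = refl

  balanced : ∀ {T} → ∣ T ∣ ≡ m → #full (word T) ≡ #empty (word T)
  balanced {T} e = sym (ℕ.+-cancelˡ-≡ m _ _ (trans (cong (_+ #empty (word T)) (sym e)) (size T)))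

  unbalanced : ∀ {T} → ∣ T ∣ ≡ suc m → #full (word T) ≡ suc (#empty (word T))
  unbalanced {T} e = ℕ.+-cancelˡ-≡ m _ _ (trans (sym (size T))
    (trans (cong (_+ #empty (word T)) e) (sym (ℕ.+-suc m _))))

  un-∁ : ∀ T j → un (∁ T) j ≡ not (un T j)
  un-∁ T j = lookup-map (j ↑ˡ m) not T

  pr-∁ : ∀ T j → pr (∁ T) j ≡ not (pr T j)
  pr-∁ T j = lookup-map (m ↑ʳ j) not T

  kind-not : ∀ a b → kind (not a) (not b) ≡ swap (kind a b)
  kind-not true  true  = refl
  kind-not true  false = refl
  kind-not false true  = refl
  kind-not false false = refl

  word-∁ : ∀ T → word (∁ T) ≗ swap ∘ word T
  word-∁ T j = trans (cong₂ kind (un-∁ T j) (pr-∁ T j)) (kind-not (un T j) (pr T j))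

  ∁-involutive : ∀ (T : Subset (m + m)) → ∁ (∁ T) ≡ T
  ∁-involutive T = trans (sym (tabulate∘lookup _)) (trans (tabulate-cong λ e →
    trans (lookup-map e not (∁ T)) (trans (cong not (lookup-map e not T)) (not-involutive _)))
    (tabulate∘lookup T))

  -- The exceptional orbits

  C⁺¹ : Subset m
  C⁺¹ = C m +ˢ 1

  w₀ w₁ : Word n
  w₀ = pairWord (C m) C⁺¹
  w₁ = pairWord C⁺¹ (C m)

  w₁≗swap-w₀ : w₁ ≗ swap ∘ w₀
  w₁≗swap-w₀ j with part m-odd j
  ... | inC   p q _ = trans (cong₂ pairKind q p) (sym (cong swap (cong₂ pairKind p q)))
  ... | inC+1 p q _ = trans (cong₂ pairKind q p) (sym (cong swap (cong₂ pairKind p q)))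
  ... | isM   p q _ = trans (cong₂ pairKind q p) (sym (cong swap (cong₂ pairKind p q)))

  C-disjoint : Disjoint (C m) C⁺¹
  C-disjoint (j , j∈) with x∈p∩q⁻ (C m) C⁺¹ j∈ | part m-odd j
  ... | _ , j∈C⁺¹ | inC   _ q _ = lookup-∉ C⁺¹ q j∈C⁺¹
  ... | j∈C , _   | inC+1 p _ _ = lookup-∉ (C m) p j∈C
  ... | j∈C , _   | isM   p _ _ = lookup-∉ (C m) p j∈C

  C-disjoint′ : Disjoint C⁺¹ (C m)
  C-disjoint′ (j , j∈) with a , b ← x∈p∩q⁻ C⁺¹ (C m) j∈ = C-disjoint (j , x∈p∩q⁺ (b , a))

  w₀-full : ∀ j → w₀ j ≡ full → j ∈ C m
  w₀-full j e with part m-odd j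
  ... | inC   p q _ = lookup⇒[]= j (C m) p
  ... | inC+1 p q _ = contradiction (trans (sym e) (cong₂ pairKind p q)) λ ()
  ... | isM   p q _ = contradiction (trans (sym e) (cong₂ pairKind p q)) λ ()

  w₀-empty : ∀ j → w₀ j ≡ empty → j ∈ C⁺¹
  w₀-empty j e with part m-odd j
  ... | inC   p q _ = contradiction (trans (sym e) (cong₂ pairKind p q)) λ ()
  ... | inC+1 p q _ = lookup⇒[]= j C⁺¹ q
  ... | isM   p q _ = contradiction (trans (sym e) (cong₂ pairKind p q)) λ ()

  w₀-half : ∀ j → w₀ j ≡ half → j ≡ fromℕ n
  w₀-half j e with part m-odd j
  ... | inC   p q _ = contradiction (trans (sym e) (cong₂ pairKind p q)) λ ()
  ... | inC+1 p q _ = contradiction (trans (sym e) (cong₂ pairKind p q)) λ ()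
  ... | isM   _ _ r = toℕ-injective (trans
    (ℕ.suc-injective (last⁻ m-odd (lookup⇒[]= j (last m) r))) (sym (toℕ-fromℕ n)))

  last∈last : fromℕ n ∈ last m
  last∈last = ∈-comprehension⁺ (λ j → label j ℕ.≟ m) (cong suc (toℕ-fromℕ n))

  w₀-last : w₀ (fromℕ n) ≡ half
  w₀-last with part m-odd (fromℕ n)
  ... | inC   _ _ r = contradiction last∈last (lookup-∉ (last m) r)
  ... | inC+1 _ _ r = contradiction last∈last (lookup-∉ (last m) r)
  ... | isM   p q _ = cong₂ pairKind p q

  w₀-alternating : Alternating w₀
  w₀-alternating = record
    { full-empty = λ j e → pairWord-∈ʳ (C m) C⁺¹ C-disjoint (∈-image⁺ (_⊕ 1) (C m) (w₀-full j e))
    ; empty-full = λ j e → case ∈-image⁻ (_⊕ 1) (C m) (w₀-empty (next j) e) of λ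
        (i , i∈ , i⊕1≡j⊕1) → pairWord-∈ˡ (C m) C⁺¹ {j} (subst (_∈ C m) (⊕1-injective i⊕1≡j⊕1) i∈)
    ; half-full  = λ j e → pairWord-∈ˡ (C m) C⁺¹ (subst (λ i → next i ∈ C m) (sym (w₀-half j e)) next-last∈C)
    ; some-half  = fromℕ n , w₀-last
    }
    where
    label-next-last : label (next (fromℕ n)) ≡ 1
    label-next-last = cong suc (trans (toℕ-⊕ (fromℕ n) 1) (trans
      (cong (_% m) (trans (ℕ.+-comm _ 1) (cong suc (toℕ-fromℕ n)))) (n%n≡0 m)))
    -- The position after the last has label 1, and this belongs to `C m` because `m` is at least 3.
    next-last∈C : next (fromℕ n) ∈ C m
    next-last∈C = C⁺ m-odd (subst Odd (sym label-next-last) (even⇒odd-suc (2 ∣0)))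
      (subst (_≤ m ∸ 2) (sym label-next-last) (ℕ.∸-monoˡ-≤ 1 2≤n))

  Exceptional : Subset (m + m) → Set
  Exceptional T = ⟨ C m ∥ C⁺¹ ⟩ T ⊎ ⟨ C⁺¹ ∥ C m ⟩ T

  exceptional? : ∀ T → Dec (Exceptional T)
  exceptional? T = ⟨ C m ∥ C⁺¹ ⟩? T ⊎-dec ⟨ C⁺¹ ∥ C m ⟩? T
    where open Decidability

  exceptional-∁ : ∀ {T} → Exceptional T → Exceptional (∁ T)
  exceptional-∁ {T} (inj₁ t) with q , turn ← ⟨∥⟩⁻ {T = T} t = inj₂ (⟨∥⟩⁺ {T = ∁ T} {q} C-disjoint′ λ j →
    trans (word-∁ T _) (trans (cong swap (turn j)) (sym (w₁≗swap-w₀ j))))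
  exceptional-∁ {T} (inj₂ t) with q , turn ← ⟨∥⟩⁻ {T = T} t = inj₁ (⟨∥⟩⁺ {T = ∁ T} {q} C-disjoint λ j →
    trans (word-∁ T _) (trans (cong swap (trans (turn j) (w₁≗swap-w₀ j))) (swap-involutive _)))

  -- Both exceptional orbits are reduced to `w₀`, as `w₁` is its complement.
  exceptional-turn : ∀ {T} → Exceptional T →
    (∃ λ q → Turn q (word T) w₀) ⊎ (∃ λ q → Turn q (swap ∘ word T) w₀)
  exceptional-turn {T} (inj₁ t) = inj₁ (⟨∥⟩⁻ {T = T} t)
  exceptional-turn {T} (inj₂ t) with q , turn ← ⟨∥⟩⁻ {T = T} t =
    inj₂ (q , λ j → trans (cong swap (trans (turn j) (w₁≗swap-w₀ j))) (swap-involutive _))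

  exceptional-alternating : ∀ {T} → Exceptional T → Alternating (word T) ⊎ Alternating (swap ∘ word T)
  exceptional-alternating {T} exc with exceptional-turn {T} exc
  ... | inj₁ (q , turn) =
    inj₁ (alternating-turn {q = q * n} (unturn {q = q} {word T} turn) w₀-alternating)
  ... | inj₂ (q , turn) =
    inj₂ (alternating-turn {q = q * n} (unturn {q = q} {swap ∘ word T} turn) w₀-alternating)

  exceptional-nonhalf : ∀ {T} → Exceptional T → NonHalf (word T)
  exceptional-nonhalf {T} exc with exceptional-alternating {T} exc
  ... | inj₁ alt = let p , e = some-half in next p , λ h → case trans (sym (half-full p e)) h of λ ()
    where open Alternating alt
  ... | inj₂ alt = let p , e = some-half in next p , λ h → case trans (sym (half-full p e)) (cong swap h) of λ ()
    where open Alternating alt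

  -- Among exceptional sets, this property singles out the rotations of `A m` and `B m`.
  HalvesUnprimed : Subset (m + m) → Set
  HalvesUnprimed T = ∀ j → word T j ≡ half → un T j ≡ true

  halvesUnprimed-rotated : ∀ {q S T} → Rotated q S T → HalvesUnprimed S → HalvesUnprimed T
  halvesUnprimed-rotated {q} {S} {T} rot@(u , _) unprimed j e = subst (λ i → un T i ≡ true) (⊕-inverseˡ j q)
    (trans (u (j ⊕ (q * n))) (unprimed (j ⊕ (q * n))
      (trans (sym (rotated-word {S = S} {T} rot (j ⊕ (q * n))))
        (trans (cong (word T) (⊕-inverseˡ j q)) e))))

  halvesUnprimed-unrotated : ∀ {q S T} → Rotated q S T → HalvesUnprimed T → HalvesUnprimed S
  halvesUnprimed-unrotated {S = S} {T} rot@(u , _) unprimed j e =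
    trans (sym (u j)) (unprimed _ (trans (rotated-word {S = S} {T} rot j) e))

  un-A : ∀ j → un (A m) j ≡ lookup (last m) j ∨ lookup C⁺¹ j
  un-A j = trans (lookup-++ˡ (last m ∪ C⁺¹) C⁺¹ j) (lookup-zipWith _∨_ j (last m) C⁺¹)

  pr-A : ∀ j → pr (A m) j ≡ lookup C⁺¹ j
  pr-A = lookup-++ʳ (last m ∪ C⁺¹) C⁺¹

  un-B : ∀ j → un (B m) j ≡ lookup (last m) j ∨ lookup (C m) j
  un-B j = trans (lookup-++ˡ (last m ∪ C m) (C m) j) (lookup-zipWith _∨_ j (last m) (C m))

  pr-B : ∀ j → pr (B m) j ≡ lookup (C m) j
  pr-B = lookup-++ʳ (last m ∪ C m) (C m)

  word-A : word (A m) ≗ w₁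
  word-A j = trans (cong₂ kind (un-A j) (pr-A j)) (eq (part m-odd j))
    where
    eq : Part m-odd j → kind (lookup (last m) j ∨ lookup C⁺¹ j) (lookup C⁺¹ j) ≡ w₁ j
    eq (inC   p q r) = trans (cong₂ (λ l c → kind (l ∨ c) c) r q) (sym (cong₂ pairKind q p))
    eq (inC+1 p q r) = trans (cong₂ (λ l c → kind (l ∨ c) c) r q) (sym (cong₂ pairKind q p))
    eq (isM   p q r) = trans (cong₂ (λ l c → kind (l ∨ c) c) r q) (sym (cong₂ pairKind q p))

  word-B : word (B m) ≗ w₀
  word-B j = trans (cong₂ kind (un-B j) (pr-B j)) (eq (part m-odd j))
    where
    eq : Part m-odd j → kind (lookup (last m) j ∨ lookup (C m) j) (lookup (C m) j) ≡ w₀ j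
    eq (inC   p q r) = trans (cong₂ (λ l c → kind (l ∨ c) c) r p) (sym (cong₂ pairKind p q))
    eq (inC+1 p q r) = trans (cong₂ (λ l c → kind (l ∨ c) c) r p) (sym (cong₂ pairKind p q))
    eq (isM   p q r) = trans (cong₂ (λ l c → kind (l ∨ c) c) r p) (sym (cong₂ pairKind p q))

  half⇒unprimed : ∀ l c → kind (l ∨ c) c ≡ half → l ∨ c ≡ true
  half⇒unprimed true  _    _ = refl
  half⇒unprimed false true _ = refl

  A-unprimed : HalvesUnprimed (A m)
  A-unprimed j e = trans (un-A j) (half⇒unprimed _ _ (trans (sym (cong₂ kind (un-A j) (pr-A j))) e))

  B-unprimed : HalvesUnprimed (B m)
  B-unprimed j e = trans (un-B j) (half⇒unprimed _ _ (trans (sym (cong₂ kind (un-B j) (pr-B j))) e))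

  -- A letter determines its pair of elements except at a half, and there both sets contain the
  -- unprimed one.
  unprimed-determined : ∀ {S T} → HalvesUnprimed S → HalvesUnprimed T → word S ≗ word T → S ≡ T
  unprimed-determined {S} {T} uS uT e = subset-ext (λ j → proj₁ (both j)) (λ j → proj₂ (both j))
    where
    fibres : ∀ a b c d → (kind a b ≡ half → a ≡ true) → (kind c d ≡ half → c ≡ true) →
             kind a b ≡ kind c d → a ≡ c × b ≡ d
    fibres true  true  true  true  _ _ _ = refl , refl
    fibres true  false true  false _ _ _ = refl , refl
    fibres false false false false _ _ _ = refl , refl
    fibres false true  _     _     h _ _ with () ← h refl
    fibres _     _     false true  _ h _ with () ← h refl
    both : ∀ j → un S j ≡ un T j × pr S j ≡ pr T j
    both j = fibres _ _ _ _ (uS j) (uT j) (e j)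

  AB : System
  AB S = S ≡ A m ⊎ S ≡ B m

  -- Rotated back, `T` has the word of `B m` or `A m` and unprimed halves, which determines it.
  orbitAB⁺ : ∀ {T} → Exceptional T → HalvesUnprimed T → orbit m AB T
  orbitAB⁺ {T} (inj₁ t) unprimed with q , S , S∈ , rot ← orbit⁻ {[ C m ∥ C⁺¹ ]} {T} t =
    orbit⁺ {AB} {S = S} {T} (inj₂ (unprimed-determined
      (halvesUnprimed-unrotated {S = S} {T} rot unprimed) B-unprimed
      λ j → trans ([∥]⁻ (C m) C⁺¹ {S} S∈ j) (sym (word-B j)))) rot
  orbitAB⁺ {T} (inj₂ t) unprimed with q , S , S∈ , rot ← orbit⁻ {[ C⁺¹ ∥ C m ]} {T} t =
    orbit⁺ {AB} {S = S} {T} (inj₁ (unprimed-determined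
      (halvesUnprimed-unrotated {S = S} {T} rot unprimed) A-unprimed
      λ j → trans ([∥]⁻ C⁺¹ (C m) {S} S∈ j) (sym (word-A j)))) rot

  orbitAB⁻ : ∀ {T} → orbit m AB T → Exceptional T × HalvesUnprimed T
  orbitAB⁻ {T} t with orbit⁻ {AB} {T} t
  ... | q , _ , inj₁ refl , rot =
    inj₂ (orbit⁺ {[ C⁺¹ ∥ C m ]} {S = A m} {T} ([∥]⁺ C⁺¹ (C m) {A m} C-disjoint′ word-A) rot) ,
    halvesUnprimed-rotated {S = A m} {T} rot A-unprimed
  ... | q , _ , inj₂ refl , rot =
    inj₁ (orbit⁺ {[ C m ∥ C⁺¹ ]} {S = B m} {T} ([∥]⁺ (C m) C⁺¹ {B m} C-disjoint word-B) rot) ,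
    halvesUnprimed-rotated {S = B m} {T} rot B-unprimed

  exceptional-some-half : ∀ {T} → Exceptional T → ∃ λ p → word T p ≡ half
  exceptional-some-half {T} exc with exceptional-alternating {T} exc
  ... | inj₁ alt = Alternating.some-half alt
  ... | inj₂ alt = let p , e = Alternating.some-half alt in
    p , trans (sym (swap-involutive _)) (cong swap e)

  -- The only half of `w₀` is at the last position, so a half of its rotation by `q` can only be at
  -- `fromℕ n ⊕ q`.
  exceptional-unique-half : ∀ {T} → Exceptional T → ∀ {i j} → word T i ≡ half → word T j ≡ half → i ≡ j
  exceptional-unique-half {T} exc {i} {j} ei ej with exceptional-turn {T} exc
  ... | inj₁ (q , turn) = trans (position i ei) (sym (position j ej))
    where
    position : ∀ i → word T i ≡ half → i ≡ fromℕ n ⊕ q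
    position i e = trans (sym (⊕-inverseˡ i q))
      (cong (_⊕ q) (w₀-half (i ⊕ (q * n)) (trans (unturn {q = q} {word T} turn i) e)))
  ... | inj₂ (q , turn) = trans (position i ei) (sym (position j ej))
    where
    position : ∀ i → word T i ≡ half → i ≡ fromℕ n ⊕ q
    position i e = trans (sym (⊕-inverseˡ i q))
      (cong (_⊕ q) (w₀-half (i ⊕ (q * n)) (trans (unturn {q = q} {swap ∘ word T} turn i) (cong swap e))))

  not-both-unprimed : ∀ {T} → Exceptional T → HalvesUnprimed T → ¬ HalvesUnprimed (∁ T)
  not-both-unprimed {T} exc u u′ with p , e ← exceptional-some-half {T} exc
    with () ← trans (sym (u′ p (trans (word-∁ T p) (cong swap e)))) (trans (un-∁ T p) (cong not (u p e)))

  -- The unique half decides for the whole set, and complementation exchanges the two elements of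
  -- its pair.
  unprimed-or-∁-unprimed : ∀ {T} → Exceptional T → HalvesUnprimed T ⊎ HalvesUnprimed (∁ T)
  unprimed-or-∁-unprimed {T} exc with p , e ← exceptional-some-half {T} exc = decide (un T p) refl
    where
    decide : ∀ b → un T p ≡ b → HalvesUnprimed T ⊎ HalvesUnprimed (∁ T)
    decide true  eq = inj₁ λ j e′ → subst (λ i → un T i ≡ true) (exceptional-unique-half {T} exc e e′) eq
    decide false eq = inj₂ λ j e′ → subst (λ i → un (∁ T) i ≡ true)
      (exceptional-unique-half {T} exc e
        (trans (sym (swap-involutive _)) (cong swap (trans (sym (word-∁ T j)) e′))))
      (trans (un-∁ T p) (cong not eq))

  -- Membership in `𝓗` and in `𝓕`

  AllHalf : Subset (m + m) → Set
  AllHalf T = ∀ j → word T j ≡ half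

  ∅-disjoint : Disjoint (∅ {m}) ∅
  ∅-disjoint (j , j∈) = ∉⊥ (proj₁ (x∈p∩q⁻ ∅ ∅ j∈))

  pairWord-∅ : ∀ j → pairWord (∅ {m}) ∅ j ≡ half
  pairWord-∅ j = pairWord-∉ ∅ ∅ {j} ∉⊥ ∉⊥

  ⟨∅∥∅⟩⇒allHalf : ∀ {T} → ⟨ ∅ {m} ∥ ∅ ⟩ T → AllHalf T
  ⟨∅∥∅⟩⇒allHalf {T} t j with q , turn ← ⟨∥⟩⁻ {T = T} t =
    trans (sym (unturn {q = q} {word T} turn j)) (pairWord-∅ (j ⊕ (q * n)))

  allHalf⇒⟨∅∥∅⟩ : ∀ {T} → AllHalf T → ⟨ ∅ {m} ∥ ∅ ⟩ T
  allHalf⇒⟨∅∥∅⟩ {T} all = ⟨∥⟩⁺ {T = T} {0} ∅-disjoint λ j → trans (all (j ⊕ 0)) (sym (pairWord-∅ j))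

  nonhalf-or-allHalf : ∀ T → NonHalf (word T) ⊎ AllHalf T
  nonhalf-or-allHalf T with any? (λ j → ¬? (word T j ≟ᴷ half))
  ... | yes nonhalf = inj₁ nonhalf
  ... | no  none    = inj₂ λ j → decidable-stable (word T j ≟ᴷ half) λ ≢half → none (j , ≢half)

  -- The pair is read off the word of `T`. As `T` itself lies in the resulting orbit, equality with
  -- a forbidden orbit would make `T` all half or exceptional.
  good⇒𝓗 : ∀ {T} → ∣ T ∣ ≡ m → NonHalf (word T) → ¬ Exceptional T → Good (word T) → 𝓗 m T
  good⇒𝓗 {T} ∣T∣≡m (p , wp) ¬exc good = inj₂ (X , Y ,
    (∣X∣≡∣Y∣ , disjoint , (λ ≐∅ → wp (⟨∅∥∅⟩⇒allHalf {T} (proj₁ ≐∅ {T} t) p))) ,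
    (λ ≐C → ¬exc (inj₁ (proj₁ ≐C {T} t))) , (λ ≐C → ¬exc (inj₂ (proj₁ ≐C {T} t))) ,
    good⇒sgn≐β X Y (p , λ e → wp (trans (w≗v p) e))
      (subst Odd (sum-cong-≗ λ j → cong (bit ∘ isHalf) (w≗v j)) (half-odd (word T) m-odd (balanced {T} ∣T∣≡m)))
      (good-cong w≗v good) ,
    t)
    where
    X Y : Subset m
    X = fulls (word T)
    Y = empties (word T)
    w≗v : word T ≗ pairWord X Y
    w≗v = pairWord-fulls-empties (word T)
    disjoint : Disjoint X Y
    disjoint = fulls-empties-disjoint (word T)
    ∣X∣≡∣Y∣ : ∣ X ∣ ≡ ∣ Y ∣
    ∣X∣≡∣Y∣ = trans (∣tabulate∣ (isFull ∘ word T))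
      (trans (balanced {T} ∣T∣≡m) (sym (∣tabulate∣ (isEmpty ∘ word T))))
    t : ⟨ X ∥ Y ⟩ T
    t = ⟨∥⟩⁺ {T = T} {0} disjoint λ j → trans (cong (word T) (⊕-multiple j 0)) (w≗v j)

  record GoodBlock (T : Subset (m + m)) : Set where
    field
      good           : Good (word T)
      nonhalf        : NonHalf (word T)
      nonexceptional : ¬ Exceptional T

  -- In the second case an exceptional or all-half `T` would lie in two orbits, which would then be
  -- equal.
  𝓗⁻ : ∀ {T} → 𝓗 m T → Exceptional T × HalvesUnprimed T ⊎ GoodBlock T
  𝓗⁻ {T} (inj₁ t) = inj₁ (orbitAB⁻ {T} t)
  𝓗⁻ {T} (inj₂ (X , Y , (_ , disjoint , ≭∅) , ≭C , ≭C′ , sgn≐β , t)) = inj₂ record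
    { good = let q , turn = ⟨∥⟩⁻ {T = T} t in
        good-turn {q = q * n} {pairWord X Y} {word T} (unturn {q = q} {word T} turn)
          (sgn-β⇒good X Y (proj₂ sgn≐β refl))
    ; nonhalf = [ id , (λ all → contradiction
        (⟨∥⟩-≐ {T = T} disjoint ∅-disjoint t (allHalf⇒⟨∅∥∅⟩ {T} all)) ≭∅) ]′ (nonhalf-or-allHalf T)
    ; nonexceptional = λ
        { (inj₁ t′) → ≭C (⟨∥⟩-≐ {T = T} disjoint C-disjoint t t′)
        ; (inj₂ t′) → ≭C′ (⟨∥⟩-≐ {T = T} disjoint C-disjoint′ t t′) }
    }

  𝓗-nonhalf : ∀ {T} → 𝓗 m T → NonHalf (word T)
  𝓗-nonhalf {T} t with 𝓗⁻ {T} t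
  ... | inj₁ (exc , _) = exceptional-nonhalf {T} exc
  ... | inj₂ g         = GoodBlock.nonhalf g

  Parity : Fin 2 → ℕ → Set
  Parity zero       k = Odd k
  Parity (suc zero) k = 2 ∣ k

  parity-suc : ∀ i k → Parity i k ⊎ Parity i (suc k)
  parity-suc i k with 2 ∣? k
  parity-suc zero       k | yes even = inj₂ (even⇒odd-suc even)
  parity-suc zero       k | no  odd  = inj₁ odd
  parity-suc (suc zero) k | yes even = inj₁ even
  parity-suc (suc zero) k | no  odd  = inj₂ (odd⇒even-suc odd)

  parity-either : ∀ i a b → Odd (a + b) → Parity i a ⊎ Parity i b
  parity-either i a b odd with 2 ∣? a | 2 ∣? b
  ... | yes even | yes even′ = contradiction (∣m∣n⇒∣m+n even even′) odd
  ... | no  odd₁ | no  odd₂  = contradiction (odd+odd odd₁ odd₂) odd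
  parity-either zero       a b odd | yes _    | no odd′ = inj₂ odd′
  parity-either zero       a b odd | no  odd′ | yes _   = inj₁ odd′
  parity-either (suc zero) a b odd | yes even | no  _   = inj₁ even
  parity-either (suc zero) a b odd | no  _    | yes even = inj₂ even

  parity-not-both : ∀ i {a b} → Odd (a + b) → Parity i a → ¬ Parity i b
  parity-not-both zero       odd odd₁ odd₂ = odd (odd+odd odd₁ odd₂)
  parity-not-both (suc zero) odd even even′ = odd (∣m∣n⇒∣m+n even even′)

  un-F : ∀ J j → un (F J) j ≡ lookup J j
  un-F J = lookup-++ˡ J (∁ J)

  pr-F : ∀ J j → pr (F J) j ≡ not (lookup J j)
  pr-F J j = trans (lookup-++ʳ J (∁ J) j) (lookup-map j not J)

  kind-half : ∀ a b → kind a b ≡ half → b ≡ not a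
  kind-half true  false _ = refl
  kind-half false true  _ = refl

  kind-a-not-a : ∀ a → kind a (not a) ≡ half
  kind-a-not-a true  = refl
  kind-a-not-a false = refl

  allHalf-F : ∀ {T} → AllHalf T → T ≡ F (tabulate (un T))
  allHalf-F {T} all = subset-ext
    (λ j → sym (trans (un-F (tabulate (un T)) j) (lookup∘tabulate (un T) j)))
    (λ j → trans (kind-half (un T j) (pr T j) (all j))
      (sym (trans (pr-F (tabulate (un T)) j) (cong not (lookup∘tabulate (un T) j)))))

  F-allHalf : ∀ J → AllHalf (F J)
  F-allHalf J j = trans (cong₂ kind (un-F J j) (pr-F J j)) (kind-a-not-a (lookup J j))

  𝓕⁺ : ∀ i {T} → AllHalf T → Parity i (# (un T)) → 𝓕 m i T
  𝓕⁺ zero       {T} all odd  =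
    tabulate (un T) , subst Odd (sym (∣tabulate∣ (un T))) odd , allHalf-F {T} all
  𝓕⁺ (suc zero) {T} all even =
    tabulate (un T) , subst (2 ∣_) (sym (∣tabulate∣ (un T))) even , allHalf-F {T} all

  ∣_∣-F : ∀ J → ∣ J ∣ ≡ # (un (F J))
  ∣ J ∣-F = trans (cong ∣_∣ (sym (tabulate∘lookup J)))
    (trans (∣tabulate∣ (lookup J)) (sum-cong-≗ λ j → cong bit (sym (un-F J j))))

  𝓕⁻ : ∀ i {T} → 𝓕 m i T → AllHalf T × Parity i (# (un T))
  𝓕⁻ zero       (J , odd  , refl) = F-allHalf J , subst Odd ∣ J ∣-F odd
  𝓕⁻ (suc zero) (J , even , refl) = F-allHalf J , subst (2 ∣_) ∣ J ∣-F even

  #un+#un-∁ : ∀ T → # (un T) + # (un (∁ T)) ≡ m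
  #un+#un-∁ T = trans (cong (# (un T) +_) (sum-cong-≗ λ j → cong bit (un-∁ T j))) (#-complement (un T))

  #un-odd : ∀ T → Odd (# (un T) + # (un (∁ T)))
  #un-odd T = subst Odd (sym (#un+#un-∁ T)) m-odd

  allHalf-∁ : ∀ {T} → AllHalf T → AllHalf (∁ T)
  allHalf-∁ {T} all j = trans (word-∁ T j) (cong swap (all j))

  -- Subsets with exactly `m` elements

  block-or-∁ : ∀ i T → ∣ T ∣ ≡ m → ∣ ∁ T ∣ ≡ m → 𝓢-blocks m i T ⊎ 𝓢-blocks m i (∁ T)
  block-or-∁ i T ∣T∣≡m ∣∁T∣≡m = [ by-state , by-parity ]′ (nonhalf-or-allHalf T)
    where
    Result : Set
    Result = 𝓢-blocks m i T ⊎ 𝓢-blocks m i (∁ T)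
    by-parity : AllHalf T → Result
    by-parity all = Sum.map
      (λ par → inj₂ (𝓕⁺ i {T} all par))
      (λ par → inj₂ (𝓕⁺ i {∁ T} (allHalf-∁ {T} all) par))
      (parity-either i (# (un T)) (# (un (∁ T))) (#un-odd T))
    by-state : NonHalf (word T) → Result
    by-state nonhalf@(p , wp) = decide (exceptional? T)
      where
      decide : Dec (Exceptional T) → Result
      decide (yes exc) = Sum.map
        (λ u → inj₁ (inj₁ (orbitAB⁺ {T} exc u)))
        (λ u → inj₁ (inj₁ (orbitAB⁺ {∁ T} (exceptional-∁ {T} exc) u)))
        (unprimed-or-∁-unprimed {T} exc)
      decide (no ¬exc) = Sum.map
        (λ good → inj₁ (good⇒𝓗 {T} ∣T∣≡m nonhalf ¬exc good))
        (λ good → inj₁ (good⇒𝓗 {∁ T} ∣∁T∣≡m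
          (p , λ e → swap-≢half wp (trans (sym (word-∁ T p)) e))
          (λ exc → ¬exc (subst Exceptional (∁-involutive T) (exceptional-∁ {∁ T} exc)))
          (good-cong (λ j → sym (word-∁ T j)) good)))
        (good-or-swap-good (word T) nonhalf (half-odd (word T) m-odd (balanced {T} ∣T∣≡m)))

  -- Complementation preserves being all half and being exceptional, so both blocks would be of the
  -- same type. Parity, the unprimed half and the sign then exclude the three cases.
  not-both-blocks : ∀ i T → ∣ T ∣ ≡ m → 𝓢-blocks m i T → ¬ 𝓢-blocks m i (∁ T)
  not-both-blocks i T _ (inj₂ f) (inj₂ f′) =
    parity-not-both i (#un-odd T) (proj₂ (𝓕⁻ i {T} f)) (proj₂ (𝓕⁻ i {∁ T} f′))
  not-both-blocks i T _ (inj₂ f) (inj₁ h′) with p , wp ← 𝓗-nonhalf {∁ T} h′ =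
    wp (allHalf-∁ {T} (proj₁ (𝓕⁻ i {T} f)) p)
  not-both-blocks i T _ (inj₁ h) (inj₂ f′) with p , wp ← 𝓗-nonhalf {T} h =
    wp (subst (λ S → word S p ≡ half) (∁-involutive T) (allHalf-∁ {∁ T} (proj₁ (𝓕⁻ i {∁ T} f′)) p))
  not-both-blocks i T ∣T∣≡m (inj₁ h) (inj₁ h′) with 𝓗⁻ {T} h | 𝓗⁻ {∁ T} h′
  ... | inj₁ (exc , u) | inj₁ (_ , u′) = not-both-unprimed {T} exc u u′
  ... | inj₁ (exc , _) | inj₂ g′ = GoodBlock.nonexceptional g′ (exceptional-∁ {T} exc)
  ... | inj₂ g | inj₁ (exc′ , _) = GoodBlock.nonexceptional g
    (subst Exceptional (∁-involutive T) (exceptional-∁ {∁ T} exc′))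
  ... | inj₂ g | inj₂ g′ = not-both-good (word T) (GoodBlock.nonhalf g)
    (half-odd (word T) m-odd (balanced {T} ∣T∣≡m)) (GoodBlock.good g)
    (good-cong (word-∁ T) (GoodBlock.good g′))

  -- Blocks inside larger subsets

  removeˡ removeʳ : Subset (m + m) → Fin m → Subset (m + m)
  removeˡ U p = U [ p ↑ˡ m ]≔ false
  removeʳ U p = U [ m ↑ʳ p ]≔ false

  un-removeˡ : ∀ U p {j} → j ≢ p → un (removeˡ U p) j ≡ un U j
  un-removeˡ U p j≢p = lookup∘update′ (λ e → j≢p (↑ˡ-injective m _ _ e)) U false

  word-removeˡ : ∀ U p j → j ≢ p → word (removeˡ U p) j ≡ word U j
  word-removeˡ U p j j≢p = cong₂ kind (un-removeˡ U p j≢p)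
    (lookup∘update′ (λ e → ↑ˡ≢↑ʳ p j (sym e)) U false)

  word-removeʳ : ∀ U p j → j ≢ p → word (removeʳ U p) j ≡ word U j
  word-removeʳ U p j j≢p = cong₂ kind (lookup∘update′ (↑ˡ≢↑ʳ j p) U false)
    (lookup∘update′ (λ e → j≢p (↑ʳ-injective m _ _ e)) U false)

  word-removeˡ-at : ∀ U p → word (removeˡ U p) p ≡ kind false (pr U p)
  word-removeˡ-at U p = cong₂ kind (lookup∘update (p ↑ˡ m) U false)
    (lookup∘update′ (λ e → ↑ˡ≢↑ʳ p p (sym e)) U false)

  word-removeʳ-at : ∀ U p → word (removeʳ U p) p ≡ kind (un U p) false
  word-removeʳ-at U p = cong₂ kind (lookup∘update′ (↑ˡ≢↑ʳ p p) U false)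
    (lookup∘update (m ↑ʳ p) U false)

  kind-full : ∀ a b → kind a b ≡ full → a ≡ true × b ≡ true
  kind-full true  true  _ = refl , refl
  kind-full true  false ()
  kind-full false true  ()

  BlockBelow : Fin 2 → Subset (m + m) → Set
  BlockBelow i U = ∃ λ T → T ⊆ U × 𝓢-blocks m i T

  ∣removed∣ : ∀ {U : Subset (m + m)} → ∣ U ∣ ≡ suc m → ∀ e → lookup U e ≡ true → ∣ U [ e ]≔ false ∣ ≡ m
  ∣removed∣ {U} ∣U∣ e h = ℕ.suc-injective (trans (∣remove∣ U e h) ∣U∣)

  -- Removing p′ rather than p makes the new half unprimed, so that an
  -- exceptional result still is a rotation of A or B.
  full-move : ∀ i {U p} → ∣ U ∣ ≡ suc m → NonHalf (word (removeʳ U p)) → word U p ≡ full →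
              (∀ w′ → Move (word U) p half w′ → Good w′) → BlockBelow i U
  full-move i {U} {p} ∣U∣ nonhalf wp good with a , b ← kind-full (un U p) (pr U p) wp =
    T , remove-⊆ U (m ↑ʳ p) , inj₁ (block (exceptional? T))
    where
    T : Subset (m + m)
    T = removeʳ U p
    Tp : word T p ≡ half
    Tp = trans (word-removeʳ-at U p) (cong (λ a → kind a false) a)
    unprimed : Exceptional T → HalvesUnprimed T
    unprimed exc j e = subst (λ i → un T i ≡ true) (exceptional-unique-half {T} exc Tp e)
      (trans (lookup∘update′ (↑ˡ≢↑ʳ p p) U false) a)
    block : Dec (Exceptional T) → 𝓗 m T
    block (yes exc) = inj₁ (orbitAB⁺ {T} exc (unprimed exc))
    block (no ¬exc) = good⇒𝓗 {T} (∣removed∣ {U} ∣U∣ (m ↑ʳ p) b) nonhalf ¬exc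
      (good (word T) (Tp , word-removeʳ U p))

  -- The element to remove is the one of the pair that `U` contains. Goodness excludes one
  -- exceptional form of the result and the extra clause excludes the other.
  half-move : ∀ i {U p} → ∣ U ∣ ≡ suc m → word U p ≡ half →
              (∀ w′ → Move (word U) p empty w′ → Good w′ × ¬ Alternating (swap ∘ w′)) → BlockBelow i U
  half-move i {U} {p} ∣U∣ wp good = decide (un U p) (pr U p) refl refl
    where
    block : ∀ {T} → ∣ T ∣ ≡ m → Move (word U) p empty (word T) → 𝓗 m T
    block {T} ∣T∣ move@(Tp , _) with g , ¬alt ← good (word T) move =
      good⇒𝓗 {T} ∣T∣ (p , λ e → case trans (sym Tp) e of λ ())
        (λ exc → [ (λ alt → alternating-not-good alt g) , ¬alt ]′ (exceptional-alternating {T} exc)) g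
    decide : ∀ a b → un U p ≡ a → pr U p ≡ b → BlockBelow i U
    decide true  b ua ub = removeˡ U p , remove-⊆ U (p ↑ˡ m) , inj₁ (block {removeˡ U p}
      (∣removed∣ {U} ∣U∣ (p ↑ˡ m) ua)
      (trans (word-removeˡ-at U p)
        (cong (kind false) (trans (kind-half (un U p) (pr U p) wp) (cong not ua))) ,
       word-removeˡ U p))
    decide false true ua ub = removeʳ U p , remove-⊆ U (m ↑ʳ p) , inj₁ (block {removeʳ U p}
      (∣removed∣ {U} ∣U∣ (m ↑ʳ p) ub)
      (trans (word-removeʳ-at U p) (cong (λ a → kind a false) ua) , word-removeʳ U p))
    decide false false ua ub with () ← trans (sym wp) (cong₂ kind ua ub)

  -- Here `p` is the only full position, and removing either element over it leaves all halves. The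
  -- two results differ by one in their number of unprimed elements, so one of them has the required
  -- parity.
  no-empties : ∀ i {U p} → ∣ U ∣ ≡ suc m → (∀ j → word U j ≢ empty) → word U p ≡ full → BlockBelow i U
  no-empties i {U} {p} ∣U∣ ≢empty wp with a , b ← kind-full (un U p) (pr U p) wp =
    decide (parity-suc i (# (un Tˡ)))
    where
    Tˡ Tʳ : Subset (m + m)
    Tˡ = removeˡ U p
    Tʳ = removeʳ U p
    allHalf : ∀ T → ∣ T ∣ ≡ m → word T p ≡ half → (∀ j → j ≢ p → word T j ≡ word U j) → AllHalf T
    allHalf T ∣T∣ Tp Tj j = is-half (word T j) (≢empty′ j) λ e →
      case trans (sym (cong isFull e)) (#-zero⁻¹ (isFull ∘ word T) #full≡0 j) of λ ()
      where
      ≢empty′ : ∀ j → word T j ≢ empty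
      ≢empty′ j e with j ≟ᶠ p
      ... | yes refl with () ← trans (sym Tp) e
      ... | no  j≢p  = ≢empty j (trans (sym (Tj j j≢p)) e)
      -- A set of `m` elements has as many full as empty letters, and here there are no empty ones.
      #full≡0 : #full (word T) ≡ 0
      #full≡0 = trans (balanced {T} ∣T∣) (#-zero λ j → dec-false (word T j ≟ᴷ empty) (≢empty′ j))
      is-half : ∀ k → k ≢ empty → k ≢ full → k ≡ half
      is-half full  _  ≢f = contradiction refl ≢f
      is-half empty ≢e _  = contradiction refl ≢e
      is-half half  _  _  = refl
    allHalfˡ : AllHalf Tˡ
    allHalfˡ = allHalf Tˡ (∣removed∣ {U} ∣U∣ (p ↑ˡ m) a)
      (trans (word-removeˡ-at U p) (cong (kind false) b)) (word-removeˡ U p)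
    allHalfʳ : AllHalf Tʳ
    allHalfʳ = allHalf Tʳ (∣removed∣ {U} ∣U∣ (m ↑ʳ p) b)
      (trans (word-removeʳ-at U p) (cong (λ a → kind a false) a)) (word-removeʳ U p)
    #un-suc : suc (# (un Tˡ)) ≡ # (un Tʳ)
    #un-suc = begin
      suc (# (un Tˡ))                ≡⟨ ℕ.+-comm 1 _ ⟩
      # (un Tˡ) + 1                  ≡⟨ cong (λ b → # (un Tˡ) + bit b)
                                          (trans (lookup∘update′ (↑ˡ≢↑ʳ p p) U false) a) ⟨
      # (un Tˡ) + bit (un Tʳ p)      ≡⟨ sum-change (bit ∘ un Tˡ) (bit ∘ un Tʳ) p (λ j j≢p →
                                          cong bit (trans (un-removeˡ U p j≢p)
                                            (sym (lookup∘update′ (↑ˡ≢↑ʳ j p) U false)))) ⟩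
      # (un Tʳ) + bit (un Tˡ p)      ≡⟨ cong (λ b → # (un Tʳ) + bit b) (lookup∘update (p ↑ˡ m) U false) ⟩
      # (un Tʳ) + 0                  ≡⟨ ℕ.+-identityʳ _ ⟩
      # (un Tʳ)                      ∎
      where open ≡-Reasoning
    decide : Parity i (# (un Tˡ)) ⊎ Parity i (suc (# (un Tˡ))) → BlockBelow i U
    decide (inj₁ par) = Tˡ , remove-⊆ U (p ↑ˡ m) , inj₂ (𝓕⁺ i {Tˡ} allHalfˡ par)
    decide (inj₂ par) = Tʳ , remove-⊆ U (m ↑ʳ p) , inj₂ (𝓕⁺ i {Tʳ} allHalfʳ (subst (Parity i) #un-suc par))

  block-below : ∀ i {U} → ∣ U ∣ ≡ suc m → BlockBelow i U
  block-below i {U} ∣U∣ = decide (any? λ j → word U j ≟ᴷ empty) (any? λ j → word U j ≟ᴷ full)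
    where
    decide : Dec (∃ λ j → word U j ≡ empty) → Dec (∃ λ j → word U j ≡ full) → BlockBelow i U
    decide _ (no none) = contradiction
      (trans (sym (unbalanced {U} ∣U∣)) (#-zero λ j → dec-false (word U j ≟ᴷ full) λ e → none (j , e))) λ ()
    decide (no none) (yes (p , wp)) = no-empties i {U} ∣U∣ (λ j e → none (j , e)) wp
    decide (yes (y , wy)) (yes _) = [
      (λ (p , wp , good) → full-move i {U} ∣U∣ (y , still-empty p wp) wp good) ,
      (λ (p , wp , good) → half-move i {U} ∣U∣ wp good) ]′
      (move-good (ℕ.<⇒≤ 2≤n) (y , λ e → case trans (sym wy) e of λ ()) (unbalanced {U} ∣U∣) (y , wy))
      where
      -- The letter at `p` was full, so the empty letter at `y` survives the removal and the result
      -- is not all half.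
      still-empty : ∀ p → word U p ≡ full → word (removeʳ U p) y ≢ half
      still-empty p wp e with y ≟ᶠ p
      ... | yes refl with () ← trans (sym wy) wp
      ... | no  y≢p  with () ← trans (sym wy) (trans (sym (word-removeʳ U p y y≢p)) e)

  block-below-large : ∀ i {U} → m < ∣ U ∣ → BlockBelow i U
  block-below-large i {U} m<∣U∣ with V , V⊆U , ∣V∣ ← subset-of-size (suc m) U m<∣U∣
    with T , T⊆V , t ← block-below i {V} ∣V∣ = T , (λ {e} e∈T → V⊆U (T⊆V e∈T)) , t

-- Self-duality

∣S∣+∣∁S∣ : (S : Subset n) → ∣ S ∣ + ∣ ∁ S ∣ ≡ n
∣S∣+∣∁S∣ []          = refl
∣S∣+∣∁S∣ (true  ∷ S) = cong suc (∣S∣+∣∁S∣ S)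
∣S∣+∣∁S∣ (false ∷ S) = trans (ℕ.+-suc _ _) (cong suc (∣S∣+∣∁S∣ S))

⊆-of-equal-size : {S T : Subset n} → S ⊆ T → ∣ S ∣ ≡ ∣ T ∣ → S ≡ T
⊆-of-equal-size {S = S} S⊆T e = ⊆-antisym S⊆T λ {i} i∈T → decidable-stable (i ∈? S) λ i∉S →
  ℕ.<-irrefl e (p⊂q⇒∣p∣<∣q∣ (S⊆T , i , i∈T , i∉S))

-- A tuple is the subset of its true coordinates, and negating it is definitionally `∁`.
-- Self-duality thus says that exactly one of `U` and `∁ U` contains a block.
selfDual : (𝒜 : SpernerSystem n) → let open SpernerSystem 𝒜 in
  (∀ U → (∃ λ S → S ⊆ U × Block S) → ¬ ∃ λ S → S ⊆ ∁ U × Block S) →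
  (∀ U → (∃ λ S → S ⊆ U × Block S) ⊎ ∃ λ S → S ⊆ ∁ U × Block S) →
  SelfDual (booleanFunction 𝒜)
selfDual 𝒜 exclusive exhaustive U = compare (below? U) (below? (∁ U))
  where
  open SpernerSystem 𝒜
  Below : Subset _ → Set
  Below U = ∃ λ S → Block S × ∀ i → i ∈ S → lookup U i ≡ true
  below? : ∀ U → Dec (Below U)
  -- The same decision as in `booleanFunction`, so that its `does` is the value of the function.
  below? U = anySubset? λ S → block? S ×-dec all? λ i → (i ∈? S) →-dec (lookup U i ≟ᵇ true)
  to : ∀ {U} → Below U → ∃ λ S → S ⊆ U × Block S
  to (S , b , h) = S , (λ {i} i∈S → lookup⇒[]= i _ (h i i∈S)) , b
  from : ∀ {U} → (∃ λ S → S ⊆ U × Block S) → Below U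
  from (S , S⊆U , b) = S , b , λ i i∈S → []=⇒lookup (S⊆U i∈S)
  compare : (d : Dec (Below U)) (d′ : Dec (Below (∁ U))) → does d ≡ not (does d′)
  compare (yes b) (yes b′) = contradiction (to b′) (exclusive U (to b))
  compare (yes _) (no  _)  = refl
  compare (no  _) (yes _)  = refl
  compare (no ¬b) (no ¬b′) with exhaustive U
  ... | inj₁ b  = contradiction (from b) ¬b
  ... | inj₂ b′ = contradiction (from b′) ¬b′

proposition3p47 : ∀ (m : ℕ) (odd : Odd m) → 3 ≤ m → (i : Fin 2) →
    SelfDual (booleanFunction (𝓢 m odd i))
proposition3p47 (suc n) odd (s≤s 2≤n) i = selfDual (𝓢 (suc n) odd i) exclusive exhaustive
  where
  open Blocks n 2≤n odd
  m : ℕ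
  m = suc n

  ∁-size : ∀ (U : Subset (m + m)) → ∣ U ∣ ≡ m → ∣ ∁ U ∣ ≡ m
  ∁-size U e = ℕ.+-cancelˡ-≡ ∣ U ∣ _ _ (trans (∣S∣+∣∁S∣ U) (sym (cong (_+ m) e)))

  -- Both `U` and `∁ U` have at least `m` of the `m + m` elements, hence exactly `m`, and so they
  -- are themselves the two blocks.
  exclusive : ∀ U → BlockBelow i U → ¬ BlockBelow i (∁ U)
  exclusive U (S , S⊆U , s) (T , T⊆∁U , t) = not-both-blocks i U ∣U∣≡m
    (subst (𝓢-blocks m i) (⊆-of-equal-size S⊆U (trans ∣S∣≡m (sym ∣U∣≡m))) s)
    (subst (𝓢-blocks m i) (⊆-of-equal-size T⊆∁U (trans ∣T∣≡m (sym (∁-size U ∣U∣≡m)))) t)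
    where
    ∣S∣≡m : ∣ S ∣ ≡ m
    ∣S∣≡m = 𝓢-size odd i s
    ∣T∣≡m : ∣ T ∣ ≡ m
    ∣T∣≡m = 𝓢-size odd i t
    m≤∣U∣ : m ≤ ∣ U ∣
    m≤∣U∣ = subst (_≤ ∣ U ∣) ∣S∣≡m (p⊆q⇒∣p∣≤∣q∣ S⊆U)
    m≤∣∁U∣ : m ≤ ∣ ∁ U ∣
    m≤∣∁U∣ = subst (_≤ ∣ ∁ U ∣) ∣T∣≡m (p⊆q⇒∣p∣≤∣q∣ T⊆∁U)
    ∣U∣≡m : ∣ U ∣ ≡ m
    ∣U∣≡m = ℕ.≤-antisym (ℕ.+-cancelʳ-≤ m _ _ (ℕ.≤-trans (ℕ.+-monoʳ-≤ ∣ U ∣ m≤∣∁U∣)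
      (ℕ.≤-reflexive (∣S∣+∣∁S∣ U)))) m≤∣U∣

  -- The sizes of `U` and `∁ U` add up to `m + m`, so if they are not both `m`, one of them exceeds
  -- `m`.
  exhaustive : ∀ U → BlockBelow i U ⊎ BlockBelow i (∁ U)
  exhaustive U with ℕ.<-cmp ∣ U ∣ m
  ... | tri> _ _ m<∣U∣ = inj₁ (block-below-large i {U} m<∣U∣)
  ... | tri≈ _ ∣U∣≡m _ = Sum.map (λ b → U , id , b) (λ b → ∁ U , id , b)
    (block-or-∁ i U ∣U∣≡m (∁-size U ∣U∣≡m))
  ... | tri< ∣U∣<m _ _ = inj₂ (block-below-large i {∁ U} (ℕ.≰⇒> λ ∣∁U∣≤m →
    ℕ.<-irrefl (∣S∣+∣∁S∣ U) (ℕ.+-mono-<-≤ ∣U∣<m ∣∁U∣≤m)))
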